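{- Let $G$ be a cactus graph containing $t\ge1$ cycles $C_1,\dots,C_t$, where $C_i$ has length $n_i$, let $\mathbb{k}$ be a field and $S=\mathbb{k}[x_1,\dots,x_{|E_G|}]$. Let $\sigma_j$ be the $j$-th elementary symmetric polynomial in $n_1,\dots,n_t$, i.e. $\sigma_0=1$ and $\sigma_j=\sum_{1\le k_1<\cdots<k_j\le t}n_{k_1}\cdots n_{k_j}$ for $1\le j\le t$. Then the facet ideal of $M(G)$ has ungraded minimal free resolution \[0\leftarrow S^{\beta_0}\leftarrow S^{\beta_1}\leftarrow\cdots\leftarrow S^{\beta_t}\leftarrow 0,\qquad \beta_i=\sum_{j=0}^i(-1)^j\binom{t-j}{i-j}\sigma_{t-j}.\]
   Context: A cactus graph is a finite connected graph each of whose blocks is either a cycle or a single edge. $E_G$ is the edge set of $G$, identified with $\{1,\dots,|E_G|\}$; $M(G)$ is the cycle matroid of $G$. The facet ideal $\mathcal{F}(N)$ of a matroid $N$ on $\{1,\dots,n\}$ is the ideal of $\mathbb{k}[x_1,\dots,x_n]$ generated by $\prod_{j\in\sigma}x_j$ for $\sigma$ a basis of $N$. An ungraded minimal free resolution is an exact (except in degree $0$) free complex resolving the module whose maps have image in $\mathfrak{m}$ times the target, $\mathfrak{m}=\langle x_1,\dots,x_n\rangle$. -}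

module Defs where

open import Level using (Level; _⊔_) renaming (suc to lsuc)
open import Algebra.Bundles using (CommutativeRing)
open import Data.Bool using (Bool; true; false; if_then_else_)
open import Data.Nat as ℕ using (ℕ; zero; suc; _≤_; _∸_)
open import Data.Nat.DivMod using (_%_; m%n<n)
open import Data.Nat.Combinatorics using () renaming (_C_ to _choose_)
open import Data.Integer as ℤ using (ℤ; +_)
open import Data.Fin using (Fin; zero; suc; toℕ; fromℕ<; inject₁; fromℕ)
open import Data.Fin.Subset using (Subset; _∈_; _∉_; _⊆_; _∪_; ⁅_⁆; ∣_∣)
open import Data.Vec as Vec using (Vec)
open import Data.Vec.Properties using (≡-dec)
open import Data.List as List using (List; []; _∷_)
open import Data.Product using (Σ; ∃; ∃-syntax; _×_; _,_; proj₁; proj₂)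
open import Data.Sum using (_⊎_)
open import Relation.Nullary using (¬_; yes; no)
open import Relation.Binary.PropositionalEquality using (_≡_; _≢_)
open import Function using (_∘_; Injective)

record Field (c ℓ : Level) : Set (lsuc (c ⊔ ℓ)) where
  field
    commutativeRing : CommutativeRing c ℓ
  open CommutativeRing commutativeRing public
  field
    0≉1     : ¬ (0# ≈ 1#)
    inverse : ∀ x → ¬ (x ≈ 0#) → ∃[ y ] (x * y ≈ 1#)

-- The polynomial ring S = k[x_1,…,x_n] (variables indexed by Fin n).
-- A polynomial is a finite formal sum of terms c·x^a (a ∈ ℕⁿ);
-- two polynomials are equal when all their coefficients agree in k.

module PolyRing {c ℓ : Level} (K : Field c ℓ) (n : ℕ) where
  open Field K using (Carrier; _≈_; _+_; _*_; 0#; 1#)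

  Monomial : Set
  Monomial = Vec ℕ n

  Poly : Set c
  Poly = List (Carrier × Monomial)

  coeff : Poly → Monomial → Carrier
  coeff []             m = 0#
  coeff ((a , m′) ∷ p) m with ≡-dec ℕ._≟_ m′ m
  ... | yes _ = a + coeff p m
  ... | no  _ = coeff p m

  infix 4 _≈P_
  _≈P_ : Poly → Poly → Set ℓ
  p ≈P q = ∀ m → coeff p m ≈ coeff q m

  0P : Poly
  0P = []

  infixl 6 _+P_
  _+P_ : Poly → Poly → Poly
  p +P q = p List.++ q

  infixl 7 _*P_
  _*P_ : Poly → Poly → Poly
  p *P q = List.concatMap (λ { (a , m) → List.map (λ { (b , m′) → (a * b , Vec.zipWith ℕ._+_ m m′) }) q }) p

  -- constant coefficient; p ∈ 𝔪 = ⟨x_1,…,x_n⟩ iff it vanishes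
  zeroMon : Monomial
  zeroMon = Vec.replicate n 0

  In𝔪 : Poly → Set ℓ
  In𝔪 p = coeff p zeroMon ≈ 0#

  monoOf : Subset n → Poly
  monoOf σ = (1# , Vec.map (λ b → if b then 1 else 0) σ) ∷ []

  ΣP : (k : ℕ) → (Fin k → Poly) → Poly
  ΣP zero    f = 0P
  ΣP (suc k) f = f zero +P ΣP k (f ∘ suc)

  FreeElt : ℕ → Set c
  FreeElt a = Fin a → Poly

  _≈V_ : ∀ {a} → FreeElt a → FreeElt a → Set ℓ
  u ≈V v = ∀ i → u i ≈P v i

  0V : ∀ {a} → FreeElt a
  0V _ = 0P

  Matrix : ℕ → ℕ → Set c
  Matrix a b = Fin a → Fin b → Poly

  apply : ∀ {a b} → Matrix a b → FreeElt b → FreeElt a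
  apply {b = b} A v i = ΣP b (λ j → A i j *P v j)

  IdealGen : ∀ {p} → (Subset n → Set p) → Poly → Set (c ⊔ ℓ ⊔ p)
  IdealGen {p} Gen q =
    ∃[ L ] (q ≈P sumL L)
    where
      sumL : List (Poly × Σ (Subset n) Gen) → Poly
      sumL []                    = 0P
      sumL ((r , (σ , _)) ∷ L)  = r *P monoOf σ +P sumL L

  ε : ∀ {b0} → FreeElt b0 → FreeElt b0 → Poly
  ε {b0} g v = ΣP b0 (λ j → v j *P g j)

  KerOut : ∀ {t} {b : Fin (suc t) → ℕ} (aug : FreeElt (b zero))
           (d : (i : Fin t) → Matrix (b (inject₁ i)) (b (suc i))) →
           (k : Fin (suc t)) → FreeElt (b k) → Set ℓ
  KerOut {b = b} aug d zero    v = ε aug v ≈P 0P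
  KerOut {b = b} aug d (suc i) v = apply (d i) v ≈V 0V

  record MinimalFreeResolution {p} (I : Poly → Set p) (t : ℕ)
                               (b : Fin (suc t) → ℕ) : Set (c ⊔ ℓ ⊔ p) where
    field
      aug : FreeElt (b zero)
      d   : (i : Fin t) → Matrix (b (inject₁ i)) (b (suc i))
      aug∈I     : ∀ j → I (aug j)
      ε-onto    : ∀ q → I q → ∃[ v ] (q ≈P ε aug v)
      isComplex : ∀ i w → KerOut {b = b} aug d (inject₁ i) (apply (d i) w)
      exact     : ∀ i v → KerOut {b = b} aug d (inject₁ i) v → ∃[ w ] (apply (d i) w ≈V v)
      exactLast : ∀ v → KerOut {b = b} aug d (fromℕ t) v → v ≈V 0V
      minimal   : ∀ i w r → In𝔪 (apply (d i) w r)

record Graph : Set where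
  field
    nv ne  : ℕ
    ends   : Fin ne → Fin nv × Fin nv
    noLoop : ∀ e → proj₁ (ends e) ≢ proj₂ (ends e)
    simple : ∀ e e′ → (ends e ≡ ends e′ ⊎ ends e ≡ (proj₂ (ends e′) , proj₁ (ends e′))) → e ≡ e′

module GraphTheory (G : Graph) where
  open Graph G

  Edge Vertex : Set
  Edge   = Fin ne
  Vertex = Fin nv

  Joins : Edge → Vertex → Vertex → Set
  Joins e u v = ends e ≡ (u , v) ⊎ ends e ≡ (v , u)

  Incident : Edge → Vertex → Set
  Incident e v = proj₁ (ends e) ≡ v ⊎ proj₂ (ends e) ≡ v

  data Walk (P : Edge → Set) : Vertex → Vertex → Set where
    []  : ∀ {u} → Walk P u u
    _∷_ : ∀ {u w v} → (Σ Edge λ e → P e × Joins e u w) → Walk P w v → Walk P u v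

  Connected : Set
  Connected = ∀ u v → Walk (λ _ → Data.Unit.⊤) u v
    where import Data.Unit

  cycSuc : ∀ {k} → Fin (suc k) → Fin (suc k)
  cycSuc {k} i = fromℕ< (m%n<n (suc (toℕ i)) (suc k))

  record Cycle : Set where
    field
      k      : ℕ
      len≥3  : 3 ≤ suc k
      vs     : Fin (suc k) → Vertex
      es     : Fin (suc k) → Edge
      vs-inj : Injective _≡_ _≡_ vs
      es-inj : Injective _≡_ _≡_ es
      joins  : ∀ i → Joins (es i) (vs i) (vs (cycSuc i))

    length : ℕ
    length = suc k

    OnCycle : Edge → Set
    OnCycle e = ∃[ i ] (es i ≡ e)

  SameEdges : Cycle → Cycle → Set
  SameEdges C D = ∀ e → (Cycle.OnCycle C e → Cycle.OnCycle D e)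
                      × (Cycle.OnCycle D e → Cycle.OnCycle C e)

  -- cycle matroid M(G): independent = acyclic edge sets; bases = maximal ones
  Acyclic : Subset ne → Set
  Acyclic X = ¬ (Σ Cycle λ C → ∀ i → Cycle.es C i ∈ X)

  IsBasis : Subset ne → Set
  IsBasis X = Acyclic X × (∀ e → e ∉ X → ¬ Acyclic (X ∪ ⁅ e ⁆))

  -- subgraph H[B] spanned by an edge set B (vertices = endpoints of B)
  InV : Subset ne → Vertex → Set
  InV B v = ∃[ e ] (e ∈ B × Incident e v)

  Nonseparable : Subset ne → Set
  Nonseparable B =
      (∃[ e ] (e ∈ B))
    × (∀ u v → InV B u → InV B v → Walk (λ e → e ∈ B) u v)
    × (∀ w u v → InV B w → InV B u → InV B v → u ≢ w → v ≢ w →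
         Walk (λ e → e ∈ B × ¬ Incident e w) u v)

  IsBlock : Subset ne → Set
  IsBlock B = Nonseparable B × (∀ B′ → B ⊆ B′ → Nonseparable B′ → B′ ≡ B)

  IsCactus : Set
  IsCactus = Connected
           × (∀ B → IsBlock B →
                ∣ B ∣ ≡ 1 ⊎ (Σ Cycle λ C → ∀ e → (e ∈ B → Cycle.OnCycle C e)
                                              × (Cycle.OnCycle C e → e ∈ B)))

-- Elementary symmetric polynomials e_j(x_1,…,x_t) (standard recursion
-- e_j(x_1,…,x_{t+1}) = e_j(x_2,…) + x_1 · e_{j-1}(x_2,…)), which equals
-- Σ_{k_1<⋯<k_j} x_{k_1}⋯x_{k_j}.

esym : (t : ℕ) → (Fin t → ℕ) → ℕ → ℕ
esym zero    f zero    = 1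
esym zero    f (suc j) = 0
esym (suc t) f zero    = 1
esym (suc t) f (suc j) = esym t (f ∘ suc) (suc j) ℕ.+ f zero ℕ.* esym t (f ∘ suc) j

bettiFormula : (t : ℕ) → (Fin t → ℕ) → ℕ → ℤ
bettiFormula t ns i = go i
  where
    term : ℕ → ℤ
    term j = sign j ℤ.* (+ (((t ∸ j) choose (i ∸ j)) ℕ.* esym t ns (t ∸ j)))
      where
        sign : ℕ → ℤ
        sign zero          = + 1
        sign (suc zero)    = ℤ.- (+ 1)
        sign (suc (suc m)) = sign m
    go : ℕ → ℤ
    go zero    = term zero
    go (suc j) = go j ℤ.+ term (suc j)

FacetIdeal : ∀ {c ℓ} (K : Field c ℓ) (G : Graph) →
             PolyRing.Poly K (Graph.ne G) → Set (c ⊔ ℓ)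
FacetIdeal K G = PolyRing.IdealGen K (Graph.ne G) (GraphTheory.IsBasis G)

{-# OPTIONS --safe #-}
-- The cycles of a cactus are edge-disjoint, so the bases of M(G) are the
-- complements of the transversals of the cycles, and the facet ideal is
-- μ J_1 ⋯ J_t, where μ is the product of the bridges and J_i is generated by the
-- products g_j = P_i / x_j, for P_i the product of the variables x_j of C_i.
-- Since the syzygies of (g_j) are (x_j u_j) with Σ u_j = 0, and since each x_j
-- is a nonzerodivisor modulo an ideal generated in the other variables, a
-- resolution F of I gives the resolution F_k^n ⊕ F_{k-1}^{n-1} of I J_i with
-- differential (a , b) ↦ (∂ a + φ b , - ∂ b), where φ parametrises the syzygies.
-- Division with remainder by a variable makes all of this constructive over a
-- field without decidable equality.
module Submission where

open import Defs
open import Level using (Level; 0ℓ; _⊔_) renaming (suc to lsuc)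
open import Algebra.Bundles using (CommutativeRing)
import Algebra.Properties.CommutativeSemigroup as CommutativeSemigroupProperties
import Algebra.Properties.Ring as RingProperties
import Algebra.Properties.Semiring.Sum as SemiringSum
open import Data.Bool using (if_then_else_)
open import Data.Empty using (⊥; ⊥-elim)
open import Data.Fin as Fin using (Fin; zero; suc; toℕ; fromℕ; fromℕ<; inject₁; punchIn)
open import Data.Fin.Properties using (any?; all?; ¬∀⟶∃¬; suc-injective; punchInᵢ≢i; toℕ<n; toℕ≤pred[n]; toℕ-fromℕ; toℕ-fromℕ<; toℕ-inject₁; fromℕ<-cong; fromℕ<-toℕ; +↔⊎; *↔×; 1↔⊤; 0↔⊥)
open import Data.Fin.Subset using (Subset; _∈_; _∉_; _⊆_; _⊃_; _∪_; ⁅_⁆; ∣_∣)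
open import Data.Fin.Subset.Induction using (⊃-wellFounded)
open import Data.Fin.Subset.Properties using (_∈?_; ⊆-antisym; p⊆p∪q; q⊆p∪q; x∈p∪q⁻; x∈⁅x⁆; x∈⁅y⁆⇒x≡y; p⊂q⇒∣p∣<∣q∣; ∣⁅x⁆∣≡1)
open import Data.Integer as ℤ using (ℤ; +_)
import Data.Integer.Properties as ℤ
open import Data.Integer.Tactic.RingSolver using (solve-∀)
open import Data.List as List using (List; []; _∷_; _++_)
open import Data.Nat as ℕ using (ℕ; zero; suc; _∸_; _≥_)
open import Data.Nat.Combinatorics using (nCk≡nC[n∸k]; nCn≡1; nCk+nC[k+1]≡[n+1]C[k+1]) renaming (_C_ to _choose_)
open import Data.Nat.DivMod using (_%_; m%n<n; m%n%n≡m%n; %-distribˡ-+; [m+n]%n≡m%n; m<n⇒m%n≡m)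
import Data.Nat.Properties as ℕ
open import Data.Product using (Σ; ∃-syntax; _×_; _,_; proj₁; proj₂)
open import Data.Product.Function.NonDependent.Propositional using (_×-↔_)
open import Data.Product.Properties using (,-injectiveʳ)
open import Data.Sum using (_⊎_; inj₁; inj₂)
open import Data.Sum.Function.Propositional using (_⊎-↔_)
open import Data.Unit using (⊤; tt)
open import Data.Vec as Vec using (Vec; []; _∷_; lookup)
open import Data.Vec.Properties using (≡-dec; zipWith-comm; zipWith-assoc; zipWith-identityˡ; lookup-replicate; lookup∘tabulate; lookup⇒[]=; []=⇒lookup; tabulate∘lookup; tabulate-cong; lookup-map; lookup-zipWith)
open import Function using (_∘_; id; case_of_; _↔_; Inverse)
open import Function.Construct.Composition using (_↔-∘_)
open import Function.Construct.Identity using (↔-id)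
open import Function.Construct.Symmetry using (↔-sym)
open import Induction.WellFounded using (Acc; acc)
open import Relation.Binary.Bundles using (Setoid)
open import Relation.Binary.PropositionalEquality as ≡ using (_≡_; _≢_)
import Relation.Binary.Reasoning.Setoid as SetoidReasoning
open import Relation.Nullary using (¬_; Dec; yes; no; does; contradiction; ¬?)
open import Relation.Nullary.Decidable using (decidable-stable; _×-dec_; _⊎-dec_; dec-true; dec-false)
open import Relation.Unary using (Pred; Decidable)

-- The entries of `φ` are the scalars `x_j` up to sign, so applying `φ` blockwise commutes with `∂`
-- on the nose. The complex for `I J_i` is thus the mapping cone of a chain map from n - 1 copies of
-- `F` to n copies; no comparison map has to be lifted, and minimality is visible in the new
-- entries. The point to prove is that for a syzygy with entries in `I` the quotients `u_j` lie in
-- `I` again. They do, because division by `x_j` commutes with multiplication by the generators of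
-- `I`, which avoid that variable. Each cone multiplies the generating polynomial of the ranks by
-- `n_i + (n_i - 1) z = n_i (1 + z) - z`. Expanding the product by the number of factors that
-- contribute `-z` gives the sum of `(-z)^j (1 + z)^(t-j) σ_(t-j)`, whose coefficient at `z^i` is
-- the stated `β_i`. Edge-disjointness comes from the blocks: the union of two cycles with a common
-- edge lies in one block, which is itself a cycle and so has the same edges as each of the two.

-- Ranks of the iterated cone and the alternating binomial sum

module BettiNumbers where
  open ≡

  -- The functions local to bettiFormula have no name outside Defs. These metas
  -- are solved by them once with-abstraction has turned their arguments into
  -- distinct variables, and the arithmetic around them into rigid heads.
  mutual
    go : (t : ℕ) → (Fin t → ℕ) → ℕ → ℕ → ℤ
    go = _

    lastTerm : (t : ℕ) → (Fin t → ℕ) → ℕ → ℕ → ℤ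
    lastTerm = _

    go-pin : ∀ t ns j → bettiFormula t ns (suc j) ≡ go t ns (suc j) j ℤ.+ lastTerm t ns j (suc j)
    go-pin t ns j with ℤ._+_ | ℕ.suc j
    ... | plus | w = refl

  mutual
    sign : (t : ℕ) → (Fin t → ℕ) → ℕ → ℕ → ℕ → ℤ
    sign = _

    -- The local `sign` descends in steps of two, so the term of index `j + 3` contains it at
    -- `suc j`. Abstracting index and argument separately determines the meta as a function of both.
    sign-pin : ∀ t ns w j → go t ns w (suc (suc (suc j))) ≡
      go t ns w (suc (suc j)) ℤ.+ sign t ns w (suc (suc (suc j))) (suc j) ℤ.*
        (+ (((t ∸ suc (suc (suc j))) choose (w ∸ suc (suc (suc j)))) ℕ.* esym t ns (t ∸ suc (suc (suc j)))))
    sign-pin t ns w j with ℤ._+_ | ℤ.sign | ℤ.∣_∣ | ℕ.suc (suc (suc j))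
    ... | plus | s | a | v with ℕ.suc j
    ... | m = refl

  altSign : ℕ → ℤ
  altSign zero    = + 1
  altSign (suc m) = ℤ.- altSign m

  sign≡altSign : ∀ t ns w j m → sign t ns w j m ≡ altSign m
  sign≡altSign t ns w j zero          = refl
  sign≡altSign t ns w j (suc zero)    = refl
  sign≡altSign t ns w j (suc (suc m)) =
    trans (sign≡altSign t ns w j m) (sym (ℤ.neg-involutive (altSign m)))

  -- Σ_j (-1)^j C(m-j, i-j) e_{m-j}, in Horner form.
  alt : (ℕ → ℤ) → ℕ → ℕ → ℤ
  alt e m       zero    = e m
  alt e zero    (suc i) = + 0
  alt e (suc m) (suc i) = + (suc m choose suc i) ℤ.* e (suc m) ℤ.- alt e m i

  alt-linear : ∀ e f g n → (∀ m → g m ≡ e m ℤ.+ n ℤ.* f m) →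
               ∀ m i → alt g m i ≡ alt e m i ℤ.+ n ℤ.* alt f m i
  alt-linear e f g n h m       zero    = h m
  alt-linear e f g n h zero    (suc i) = sym (trans (ℤ.+-identityˡ _) (ℤ.*-zeroʳ n))
  alt-linear e f g n h (suc m) (suc i) =
    trans (cong₂ (λ x y → + (suc m choose suc i) ℤ.* x ℤ.- y) (h (suc m)) (alt-linear e f g n h m i))
          (ring (+ (suc m choose suc i)) (e (suc m)) (f (suc m)) (alt e m i) (alt f m i) n)
    where
    ring : ∀ c a b x y n → c ℤ.* (a ℤ.+ n ℤ.* b) ℤ.- (x ℤ.+ n ℤ.* y) ≡
                           (c ℤ.* a ℤ.- x) ℤ.+ n ℤ.* (c ℤ.* b ℤ.- y)
    ring = solve-∀

  -- With this shift, adding a variable `n` replaces the sequence `e` of elementary symmetric values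
  -- by `e + n * delay e`.
  delay : (ℕ → ℤ) → ℕ → ℤ
  delay e zero    = + 0
  delay e (suc m) = e m

  pascal : ∀ m i → + (suc m choose suc i) ≡ + (m choose i) ℤ.+ + (m choose suc i)
  pascal m i = cong +_ (sym (nCk+nC[k+1]≡[n+1]C[k+1] m i))

  choose-zero : ∀ m → m choose 0 ≡ 1
  choose-zero m = trans (nCk≡nC[n∸k] {0} {m} ℕ.z≤n) (nCn≡1 m)

  -- On the generating polynomials in `z` of `alt e m`, the delay amounts to multiplication by
  -- `1 + z`; on coefficients this is Pascal's rule.
  alt-delay : ∀ e m i → alt (delay e) (suc m) (suc i) ≡ alt e m (suc i) ℤ.+ alt e m i
  alt-delay e zero zero    = ring (e 0)
    where ring : ∀ a → + 1 ℤ.* a ℤ.- + 0 ≡ + 0 ℤ.+ a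
          ring = solve-∀
  alt-delay e zero (suc i) = refl
  alt-delay e (suc m) zero = begin
    + (suc (suc m) choose 1) ℤ.* e (suc m) ℤ.- e m
      ≡⟨ cong (λ c → c ℤ.* e (suc m) ℤ.- e m) (pascal (suc m) 0) ⟩
    (+ (suc m choose 0) ℤ.+ + (suc m choose 1)) ℤ.* e (suc m) ℤ.- e m
      ≡⟨ cong (λ c → (+ c ℤ.+ + (suc m choose 1)) ℤ.* e (suc m) ℤ.- e m) (choose-zero (suc m)) ⟩
    (+ 1 ℤ.+ + (suc m choose 1)) ℤ.* e (suc m) ℤ.- e m
      ≡⟨ ring (+ (suc m choose 1)) (e (suc m)) (e m) ⟩
    alt e (suc m) 1 ℤ.+ alt e (suc m) 0 ∎
    where open ≡-Reasoning
          ring : ∀ c a x → (+ 1 ℤ.+ c) ℤ.* a ℤ.- x ≡ (c ℤ.* a ℤ.- x) ℤ.+ a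
          ring = solve-∀
  alt-delay e (suc m) (suc i) = begin
    + (suc (suc m) choose suc (suc i)) ℤ.* e (suc m) ℤ.- alt (delay e) (suc m) (suc i)
      ≡⟨ cong₂ (λ c x → c ℤ.* e (suc m) ℤ.- x) (pascal (suc m) (suc i)) (alt-delay e m i) ⟩
    (+ (suc m choose suc i) ℤ.+ + (suc m choose suc (suc i))) ℤ.* e (suc m) ℤ.- (alt e m (suc i) ℤ.+ alt e m i)
      ≡⟨ ring (+ (suc m choose suc i)) (+ (suc m choose suc (suc i))) (e (suc m)) (alt e m (suc i)) (alt e m i) ⟩
    alt e (suc m) (suc (suc i)) ℤ.+ alt e (suc m) (suc i) ∎
    where open ≡-Reasoning
          ring : ∀ c d a x y → (c ℤ.+ d) ℤ.* a ℤ.- (x ℤ.+ y) ≡ (d ℤ.* a ℤ.- x) ℤ.+ (c ℤ.* a ℤ.- y)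
          ring = solve-∀

  -- The coefficients of the product of the polynomials `(ms i + 1) + ms i * z`, where `ms i` is one
  -- less than the length of a cycle.
  rank : ∀ t → (Fin t → ℕ) → ℕ → ℕ
  rank zero    ms zero    = 1
  rank zero    ms (suc k) = 0
  rank (suc t) ms zero    = suc (ms zero) ℕ.* rank t (ms ∘ suc) zero
  rank (suc t) ms (suc k) = suc (ms zero) ℕ.* rank t (ms ∘ suc) (suc k) ℕ.+ ms zero ℕ.* rank t (ms ∘ suc) k

  rank-high : ∀ t ms k → t ℕ.< k → rank t ms k ≡ 0
  rank-high zero    ms (suc k) _          = refl
  rank-high (suc t) ms (suc k) (ℕ.s≤s t<k)
    rewrite rank-high t (ms ∘ suc) (suc k) (ℕ.m<n⇒m<1+n t<k) | rank-high t (ms ∘ suc) k t<k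
          | ℕ.*-zeroʳ (ms zero) = refl

  esym-high : ∀ t ns j → t ℕ.< j → esym t ns j ≡ 0
  esym-high zero    ns (suc j) _ = refl
  esym-high (suc t) ns (suc j) (ℕ.s≤s t<j)
    rewrite esym-high t (ns ∘ suc) (suc j) (ℕ.m<n⇒m<1+n t<j) | esym-high t (ns ∘ suc) j t<j = ℕ.*-zeroʳ (ns zero)

  esym-zero : ∀ t ns → esym t ns 0 ≡ 1
  esym-zero zero    ns = refl
  esym-zero (suc t) ns = refl

  -- The new factor is `n (1 + z) - z`. The delayed summand supplies `n (1 + z)` by `alt-delay`; the
  -- other one supplies `-z`, because `e (suc t)` vanishes for only `t` variables and leaves just
  -- the negated tail of `alt`.
  alt-esym : ∀ t ms i → + rank t ms i ≡ alt (λ j → + esym t (λ k → suc (ms k)) j) t i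
  alt-esym zero    ms zero    = refl
  alt-esym zero    ms (suc i) = refl
  alt-esym (suc t) ms i = begin
    + rank (suc t) ms i                                      ≡⟨ step i ⟩
    alt e (suc t) i ℤ.+ n ℤ.* alt (delay e) (suc t) i        ≡⟨ alt-linear e (delay e) _ n e′≡ (suc t) i ⟨
    alt (λ j → + esym (suc t) (λ k → suc (ms k)) j) (suc t) i ∎
    where
    open ≡-Reasoning
    n = + suc (ms zero)
    e : ℕ → ℤ
    e j = + esym t (λ k → suc (ms (suc k))) j
    e-top : e (suc t) ≡ + 0
    e-top = cong +_ (esym-high t _ (suc t) ℕ.≤-refl)
    e′≡ : ∀ m → + esym (suc t) (λ k → suc (ms k)) m ≡ e m ℤ.+ n ℤ.* delay e m
    e′≡ zero    = trans (cong +_ (sym (esym-zero t _))) (sym (trans (cong (λ z → e 0 ℤ.+ z) (ℤ.*-zeroʳ n)) (ℤ.+-identityʳ _)))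
    e′≡ (suc m) = trans (ℤ.pos-+ (esym t (λ k → suc (ms (suc k))) (suc m)) _) (cong (λ z → e (suc m) ℤ.+ z) (ℤ.pos-* (suc (ms zero)) _))
    step : ∀ i → + rank (suc t) ms i ≡ alt e (suc t) i ℤ.+ n ℤ.* alt (delay e) (suc t) i
    step zero = begin
      + (suc (ms zero) ℕ.* rank t (ms ∘ suc) 0)  ≡⟨ ℤ.pos-* (suc (ms zero)) _ ⟩
      n ℤ.* + rank t (ms ∘ suc) 0                ≡⟨ cong (n ℤ.*_) (alt-esym t (ms ∘ suc) 0) ⟩
      n ℤ.* e t                                  ≡⟨ ℤ.+-identityˡ _ ⟨
      + 0 ℤ.+ n ℤ.* e t                          ≡⟨ cong (ℤ._+ n ℤ.* e t) e-top ⟨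
      e (suc t) ℤ.+ n ℤ.* e t                    ∎
    step (suc i) = begin
      + (suc (ms zero) ℕ.* rank t (ms ∘ suc) (suc i) ℕ.+ ms zero ℕ.* rank t (ms ∘ suc) i)
        ≡⟨ ℤ.pos-+ (suc (ms zero) ℕ.* rank t (ms ∘ suc) (suc i)) _ ⟩
      + (suc (ms zero) ℕ.* rank t (ms ∘ suc) (suc i)) ℤ.+ + (ms zero ℕ.* rank t (ms ∘ suc) i)
        ≡⟨ cong₂ ℤ._+_ (ℤ.pos-* (suc (ms zero)) _) (ℤ.pos-* (ms zero) _) ⟩
      n ℤ.* + rank t (ms ∘ suc) (suc i) ℤ.+ + ms zero ℤ.* + rank t (ms ∘ suc) i
        ≡⟨ cong₂ (λ a b → n ℤ.* a ℤ.+ + ms zero ℤ.* b) (alt-esym t (ms ∘ suc) (suc i)) (alt-esym t (ms ∘ suc) i) ⟩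
      n ℤ.* alt e t (suc i) ℤ.+ + ms zero ℤ.* alt e t i
        ≡⟨ ring (+ (suc t choose suc i)) (+ ms zero) (alt e t (suc i)) (alt e t i) ⟩
      (+ (suc t choose suc i) ℤ.* + 0 ℤ.- alt e t i) ℤ.+ n ℤ.* (alt e t (suc i) ℤ.+ alt e t i)
        ≡⟨ cong₂ (λ a b → (+ (suc t choose suc i) ℤ.* a ℤ.- alt e t i) ℤ.+ n ℤ.* b) (sym e-top) (sym (alt-delay e t i)) ⟩
      alt e (suc t) (suc i) ℤ.+ n ℤ.* alt (delay e) (suc t) (suc i) ∎
      where ring : ∀ c m x y → (+ 1 ℤ.+ m) ℤ.* x ℤ.+ m ℤ.* y ≡ (c ℤ.* + 0 ℤ.- y) ℤ.+ (+ 1 ℤ.+ m) ℤ.* (x ℤ.+ y)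
            ring = solve-∀

  module _ (t : ℕ) (ns : Fin t → ℕ) (i : ℕ) (i≤t : i ℕ.≤ t) where
    private
      e : ℕ → ℤ
      e j = + esym t ns j

    term≡ : ∀ j → sign t ns i j j ℤ.* + (((t ∸ j) choose (i ∸ j)) ℕ.* esym t ns (t ∸ j))
                ≡ altSign j ℤ.* (+ ((t ∸ j) choose (i ∸ j)) ℤ.* e (t ∸ j))
    term≡ j = cong₂ ℤ._*_ (sign≡altSign t ns i j j) (ℤ.pos-* ((t ∸ j) choose (i ∸ j)) _)

    -- Since `j < i ≤ t`, both truncated differences are successors, and the recursive clause of
    -- `alt` applies.
    alt-unfold : ∀ j → j ℕ.< i → alt e (t ∸ j) (i ∸ j) ≡
      + ((t ∸ j) choose (i ∸ j)) ℤ.* e (t ∸ j) ℤ.- alt e (t ∸ suc j) (i ∸ suc j)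
    alt-unfold j j<i rewrite ℕ.+-∸-assoc 1 (ℕ.<-≤-trans j<i i≤t) | ℕ.+-∸-assoc 1 j<i = refl

    -- The invariant of the summation: each step moves one term out of the Horner tail, and the tail
    -- carries the sign of the index at which it starts.
    go-partial : ∀ j → j ℕ.< i → go t ns i j ℤ.+ altSign (suc j) ℤ.* alt e (t ∸ suc j) (i ∸ suc j) ≡ alt e t i
    go-partial zero    0<i = begin
      go t ns i 0 ℤ.+ altSign 1 ℤ.* alt e (t ∸ 1) (i ∸ 1)
        ≡⟨ cong (ℤ._+ altSign 1 ℤ.* alt e (t ∸ 1) (i ∸ 1)) (term≡ 0) ⟩
      + 1 ℤ.* (+ (t choose i) ℤ.* e t) ℤ.+ ℤ.- + 1 ℤ.* alt e (t ∸ 1) (i ∸ 1)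
        ≡⟨ ring (+ (t choose i) ℤ.* e t) (alt e (t ∸ 1) (i ∸ 1)) ⟩
      + (t choose i) ℤ.* e t ℤ.- alt e (t ∸ 1) (i ∸ 1)
        ≡⟨ alt-unfold 0 0<i ⟨
      alt e t i ∎
      where open ≡-Reasoning
            ring : ∀ a b → + 1 ℤ.* a ℤ.+ ℤ.- + 1 ℤ.* b ≡ a ℤ.- b
            ring = solve-∀
    go-partial (suc j) j<i = begin
      go t ns i j ℤ.+ sign t ns i (suc j) (suc j) ℤ.* + (((t ∸ suc j) choose (i ∸ suc j)) ℕ.* esym t ns (t ∸ suc j)) ℤ.+ altSign (suc (suc j)) ℤ.* rest
        ≡⟨ cong (λ z → go t ns i j ℤ.+ z ℤ.+ altSign (suc (suc j)) ℤ.* rest) (term≡ (suc j)) ⟩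
      go t ns i j ℤ.+ altSign (suc j) ℤ.* c ℤ.+ ℤ.- altSign (suc j) ℤ.* rest
        ≡⟨ ring (go t ns i j) (altSign (suc j)) c rest ⟩
      go t ns i j ℤ.+ altSign (suc j) ℤ.* (c ℤ.- rest)
        ≡⟨ cong (λ z → go t ns i j ℤ.+ altSign (suc j) ℤ.* z) (alt-unfold (suc j) j<i) ⟨
      go t ns i j ℤ.+ altSign (suc j) ℤ.* alt e (t ∸ suc j) (i ∸ suc j)
        ≡⟨ go-partial j (ℕ.<-trans (ℕ.n<1+n j) j<i) ⟩
      alt e t i ∎
      where open ≡-Reasoning
            c = + ((t ∸ suc j) choose (i ∸ suc j)) ℤ.* e (t ∸ suc j)
            rest = alt e (t ∸ suc (suc j)) (i ∸ suc (suc j))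
            ring : ∀ g s c r → g ℤ.+ s ℤ.* c ℤ.+ ℤ.- s ℤ.* r ≡ g ℤ.+ s ℤ.* (c ℤ.- r)
            ring = solve-∀

  bettiFormula≡alt : ∀ t ns i → i ℕ.≤ t → bettiFormula t ns i ≡ alt (λ j → + esym t ns j) t i
  bettiFormula≡alt t ns zero    i≤t =
    trans (term≡ t ns 0 i≤t 0) (trans (ℤ.*-identityˡ _)
      (trans (cong (λ c → + c ℤ.* + esym t ns t) (choose-zero t)) (ℤ.*-identityˡ _)))
  bettiFormula≡alt t ns (suc i) i≤t = begin
    go t ns (suc i) i ℤ.+ sign t ns (suc i) (suc i) (suc i) ℤ.* + (((t ∸ suc i) choose (suc i ∸ suc i)) ℕ.* esym t ns (t ∸ suc i))
      ≡⟨ cong (λ z → go t ns (suc i) i ℤ.+ z) (term≡ t ns (suc i) i≤t (suc i)) ⟩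
    go t ns (suc i) i ℤ.+ altSign (suc i) ℤ.* (+ ((t ∸ suc i) choose (i ∸ i)) ℤ.* + esym t ns (t ∸ suc i))
      ≡⟨ cong (λ z → go t ns (suc i) i ℤ.+ altSign (suc i) ℤ.* z) (top (i ∸ i) (ℕ.n∸n≡0 i)) ⟩
    go t ns (suc i) i ℤ.+ altSign (suc i) ℤ.* alt (λ j → + esym t ns j) (t ∸ suc i) (i ∸ i)
      ≡⟨ go-partial t ns (suc i) i≤t i ℕ.≤-refl ⟩
    alt (λ j → + esym t ns j) t (suc i) ∎
    where
    open ≡-Reasoning
    -- For a variable `i` the difference `i ∸ i` does not reduce to zero, so it is generalised to a
    -- `d` with a proof that it is zero.
    top : ∀ d → d ≡ 0 → + ((t ∸ suc i) choose d) ℤ.* + esym t ns (t ∸ suc i) ≡ alt (λ j → + esym t ns j) (t ∸ suc i) d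
    top .0 refl = trans (cong (λ c → + c ℤ.* + esym t ns (t ∸ suc i)) (choose-zero (t ∸ suc i))) (ℤ.*-identityˡ _)

  rank≡bettiFormula : ∀ t ms i → i ℕ.≤ t → + rank t ms i ≡ bettiFormula t (λ k → suc (ms k)) i
  rank≡bettiFormula t ms i i≤t = trans (alt-esym t ms i) (sym (bettiFormula≡alt t _ i i≤t))

open BettiNumbers using (rank; rank-high; rank≡bettiFormula)

-- Exponent vectors

infixl 6 _⊕_ _⊖_
_⊕_ _⊖_ : ∀ {n} → Vec ℕ n → Vec ℕ n → Vec ℕ n
_⊕_ = Vec.zipWith ℕ._+_
_⊖_ = Vec.zipWith ℕ._∸_

𝟘 : ∀ {n} → Vec ℕ n
𝟘 = Vec.replicate _ 0

⊕-comm : ∀ {n} (s m : Vec ℕ n) → s ⊕ m ≡ m ⊕ s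
⊕-comm = zipWith-comm ℕ.+-comm

⊕-assoc : ∀ {n} (r s m : Vec ℕ n) → (r ⊕ s) ⊕ m ≡ r ⊕ (s ⊕ m)
⊕-assoc = zipWith-assoc ℕ.+-assoc

⊕-identityˡ : ∀ {n} (m : Vec ℕ n) → 𝟘 ⊕ m ≡ m
⊕-identityˡ = zipWith-identityˡ (λ _ → ≡.refl)

⊕-⊖ : ∀ {n} (s m : Vec ℕ n) → (s ⊕ m) ⊖ s ≡ m
⊕-⊖ []      []      = ≡.refl
⊕-⊖ (a ∷ s) (b ∷ m) = ≡.cong₂ _∷_ (ℕ.m+n∸m≡n a b) (⊕-⊖ s m)

⊕-cancelˡ : ∀ {n} (s : Vec ℕ n) {m m′} → s ⊕ m ≡ s ⊕ m′ → m ≡ m′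
⊕-cancelˡ s {m} {m′} eq = ≡.trans (≡.sym (⊕-⊖ s m)) (≡.trans (≡.cong (_⊖ s) eq) (⊕-⊖ s m′))

Disjoint : ∀ {n} → Vec ℕ n → Vec ℕ n → Set
Disjoint s r = ∀ e → lookup s e ≡ 0 ⊎ lookup r e ≡ 0

-- In every coordinate one of `s` and `r` is zero, so truncation in `⊖` cannot be affected by adding
-- `s`.
⊕-⊖-disjoint : ∀ {n} (s r m : Vec ℕ n) → Disjoint s r → (s ⊕ m) ⊖ r ≡ s ⊕ (m ⊖ r)
⊕-⊖-disjoint []      []      []      _ = ≡.refl
⊕-⊖-disjoint (a ∷ s) (b ∷ r) (c ∷ m) d = ≡.cong₂ _∷_ (head (d zero)) (⊕-⊖-disjoint s r m (d ∘ suc))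
  where
  head : a ≡ 0 ⊎ b ≡ 0 → (a ℕ.+ c) ℕ.∸ b ≡ a ℕ.+ (c ℕ.∸ b)
  head (inj₁ ≡.refl) = ≡.refl
  head (inj₂ ≡.refl) = ≡.refl

⊕-⊖-swap : ∀ {n} (s r m : Vec ℕ n) → Disjoint s r → r ⊕ ((s ⊕ m) ⊖ r) ≡ s ⊕ (r ⊕ (m ⊖ r))
⊕-⊖-swap s r m d = ≡.trans (≡.cong (r ⊕_) (⊕-⊖-disjoint s r m d)) (≡.trans (≡.sym (⊕-assoc r s _))
  (≡.trans (≡.cong (_⊕ (m ⊖ r)) (⊕-comm r s)) (⊕-assoc s r _)))

⊕-zeroˡ : ∀ {n} (s m : Vec ℕ n) → s ⊕ m ≡ 𝟘 → s ≡ 𝟘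
⊕-zeroˡ []      []      _  = ≡.refl
⊕-zeroˡ (a ∷ s) (b ∷ m) eq =
  ≡.cong₂ _∷_ (ℕ.m+n≡0⇒m≡0 a (≡.cong Vec.head eq)) (⊕-zeroˡ s m (≡.cong Vec.tail eq))

-- The polynomial ring as a commutative ring

module Polynomials {c ℓ : Level} (K : Field c ℓ) (n : ℕ) where
  open Field K hiding (zero)
  open PolyRing K n

  coeff-++ : ∀ p q m → coeff (p ++ q) m ≈ coeff p m + coeff q m
  coeff-++ []             q m = sym (+-identityˡ _)
  coeff-++ ((a , m′) ∷ p) q m with ≡-dec ℕ._≟_ m′ m
  ... | yes _ = trans (+-congˡ (coeff-++ p q m)) (sym (+-assoc _ _ _))
  ... | no  _ = coeff-++ p q m

  -- The coefficient at `m` of `x^s q`. Divisibility of `x^m` by `x^s` is tested by subtracting with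
  -- truncation and adding back.
  shifted : Monomial → Poly → Monomial → Carrier
  shifted s q m with ≡-dec ℕ._≟_ (s ⊕ (m ⊖ s)) m
  ... | yes _ = coeff q (m ⊖ s)
  ... | no  _ = 0#

  shifted-cong : ∀ s {q r} m → q ≈P r → shifted s q m ≈ shifted s r m
  shifted-cong s m q≈r with ≡-dec ℕ._≟_ (s ⊕ (m ⊖ s)) m
  ... | yes _ = q≈r (m ⊖ s)
  ... | no  _ = refl

  shifted-++ : ∀ s q r m → shifted s (q ++ r) m ≈ shifted s q m + shifted s r m
  shifted-++ s q r m with ≡-dec ℕ._≟_ (s ⊕ (m ⊖ s)) m
  ... | yes _ = coeff-++ q r (m ⊖ s)
  ... | no  _ = sym (+-identityˡ _)

  -- The function mapped inside `_*P_` is an anonymous lambda; it enters as an arbitrary `f`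
  -- together with its defining equation.
  coeff-term : ∀ a s (f : Carrier × Monomial → Carrier × Monomial) →
               (∀ b m′ → f (b , m′) ≡ (a * b , s ⊕ m′)) →
               ∀ q m → coeff (List.map f q) m ≈ a * shifted s q m
  coeff-term a s f f≡ [] m with ≡-dec ℕ._≟_ (s ⊕ (m ⊖ s)) m
  ... | yes _ = sym (zeroʳ a)
  ... | no  _ = sym (zeroʳ a)
  coeff-term a s f f≡ ((b , m′) ∷ q) m rewrite f≡ b m′
    with ≡-dec ℕ._≟_ (s ⊕ m′) m | ≡-dec ℕ._≟_ (s ⊕ (m ⊖ s)) m | coeff-term a s f f≡ q m
  ... | no  _  | no  _  | ih = ih
  ... | yes eq | no  ne | ih = contradiction
    (≡.trans (≡.cong (λ z → s ⊕ (z ⊖ s)) (≡.sym eq)) (≡.trans (≡.cong (s ⊕_) (⊕-⊖ s m′)) eq)) ne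
  ... | yes eq | yes _  | ih with ≡-dec ℕ._≟_ m′ (m ⊖ s)
  ...   | yes _  = trans (+-congˡ ih) (sym (distribˡ a b _))
  ...   | no  ne = contradiction (≡.trans (≡.sym (⊕-⊖ s m′)) (≡.cong (_⊖ s) eq)) ne
  coeff-term a s f f≡ ((b , m′) ∷ q) m | no ne | yes eq | ih with ≡-dec ℕ._≟_ m′ (m ⊖ s)
  ...   | yes e = contradiction (≡.trans (≡.cong (s ⊕_) e) eq) ne
  ...   | no  _ = ih

  coeff-∷* : ∀ a s p q m → coeff (((a , s) ∷ p) *P q) m ≈ a * shifted s q m + coeff (p *P q) m
  coeff-∷* a s p q m =
    trans (coeff-++ (List.map _ q) (p *P q) m) (+-congʳ (coeff-term a s _ (λ _ _ → ≡.refl) q m))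

  +P-cong : ∀ {p p′ q q′} → p ≈P p′ → q ≈P q′ → p +P q ≈P p′ +P q′
  +P-cong {p} {p′} {q} {q′} e f m =
    trans (coeff-++ p q m) (trans (+-cong (e m) (f m)) (sym (coeff-++ p′ q′ m)))

  +P-comm : ∀ p q → p +P q ≈P q +P p
  +P-comm p q m = trans (coeff-++ p q m) (trans (+-comm _ _) (sym (coeff-++ q p m)))

  +P-assoc : ∀ p q r → (p +P q) +P r ≈P p +P (q +P r)
  +P-assoc p q r m = begin
    coeff ((p ++ q) ++ r) m                 ≈⟨ coeff-++ (p ++ q) r m ⟩
    coeff (p ++ q) m + coeff r m            ≈⟨ +-congʳ (coeff-++ p q m) ⟩
    coeff p m + coeff q m + coeff r m       ≈⟨ +-assoc _ _ _ ⟩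
    coeff p m + (coeff q m + coeff r m)     ≈⟨ +-congˡ (coeff-++ q r m) ⟨
    coeff p m + coeff (q ++ r) m            ≈⟨ coeff-++ p (q ++ r) m ⟨
    coeff (p ++ (q ++ r)) m                 ∎
    where open SetoidReasoning setoid

  -P_ : Poly → Poly
  -P_ = List.map (λ t → (- proj₁ t , proj₂ t))

  coeff-neg : ∀ p m → coeff (-P p) m ≈ - coeff p m
  coeff-neg []             m = sym -0#≈0#
    where open RingProperties ring using (-0#≈0#)
  coeff-neg ((a , m′) ∷ p) m with ≡-dec ℕ._≟_ m′ m
  ... | yes _ = trans (+-congˡ (coeff-neg p m)) (-‿+-comm _ _)
    where open RingProperties ring using (-‿+-comm)
  ... | no  _ = coeff-neg p m

  -P-cong : ∀ {p q} → p ≈P q → -P p ≈P -P q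
  -P-cong {p} {q} e m = trans (coeff-neg p m) (trans (-‿cong (e m)) (sym (coeff-neg q m)))

  -P-inverseʳ : ∀ p → p +P (-P p) ≈P 0P
  -P-inverseʳ p m = trans (coeff-++ p (-P p) m) (trans (+-congˡ (coeff-neg p m)) (-‿inverseʳ _))

  *P-congˡ : ∀ p {q r} → q ≈P r → p *P q ≈P p *P r
  *P-congˡ []            q≈r m = refl
  *P-congˡ ((a , s) ∷ p) {q} {r} q≈r m = begin
    coeff (((a , s) ∷ p) *P q) m           ≈⟨ coeff-∷* a s p q m ⟩
    a * shifted s q m + coeff (p *P q) m   ≈⟨ +-cong (*-congˡ (shifted-cong s m q≈r)) (*P-congˡ p q≈r m) ⟩
    a * shifted s r m + coeff (p *P r) m   ≈⟨ coeff-∷* a s p r m ⟨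
    coeff (((a , s) ∷ p) *P r) m           ∎
    where open SetoidReasoning setoid

  distribˡP : ∀ p q r → p *P (q +P r) ≈P p *P q +P p *P r
  distribˡP []            q r m = refl
  distribˡP ((a , s) ∷ p) q r m = begin
    coeff (((a , s) ∷ p) *P (q ++ r)) m
      ≈⟨ coeff-∷* a s p (q ++ r) m ⟩
    a * shifted s (q ++ r) m + coeff (p *P (q ++ r)) m
      ≈⟨ +-cong (trans (*-congˡ (shifted-++ s q r m)) (distribˡ _ _ _))
                (trans (distribˡP p q r m) (coeff-++ (p *P q) (p *P r) m)) ⟩
    (a * shifted s q m + a * shifted s r m) + (coeff (p *P q) m + coeff (p *P r) m)
      ≈⟨ interchange _ _ _ _ ⟩
    (a * shifted s q m + coeff (p *P q) m) + (a * shifted s r m + coeff (p *P r) m)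
      ≈⟨ +-cong (coeff-∷* a s p q m) (coeff-∷* a s p r m) ⟨
    coeff (((a , s) ∷ p) *P q) m + coeff (((a , s) ∷ p) *P r) m
      ≈⟨ coeff-++ (((a , s) ∷ p) *P q) (((a , s) ∷ p) *P r) m ⟨
    coeff (((a , s) ∷ p) *P q +P ((a , s) ∷ p) *P r) m ∎
    where
    open SetoidReasoning setoid
    open CommutativeSemigroupProperties +-commutativeSemigroup using (interchange)

  distribʳP : ∀ r p q → (p +P q) *P r ≈P p *P r +P q *P r
  distribʳP r []            q m = refl
  distribʳP r ((a , s) ∷ p) q m = begin
    coeff (((a , s) ∷ (p ++ q)) *P r) m
      ≈⟨ coeff-∷* a s (p ++ q) r m ⟩
    a * shifted s r m + coeff ((p ++ q) *P r) m
      ≈⟨ +-congˡ (trans (distribʳP r p q m) (coeff-++ (p *P r) (q *P r) m)) ⟩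
    a * shifted s r m + (coeff (p *P r) m + coeff (q *P r) m)
      ≈⟨ +-assoc _ _ _ ⟨
    a * shifted s r m + coeff (p *P r) m + coeff (q *P r) m
      ≈⟨ +-congʳ (coeff-∷* a s p r m) ⟨
    coeff (((a , s) ∷ p) *P r) m + coeff (q *P r) m
      ≈⟨ coeff-++ (((a , s) ∷ p) *P r) (q *P r) m ⟨
    coeff (((a , s) ∷ p) *P r +P q *P r) m ∎
    where open SetoidReasoning setoid

  monomial : Carrier → Monomial → Poly
  monomial a m = (a , m) ∷ []

  monomial-cong : ∀ {a b s s′} → a ≈ b → s ≡ s′ → monomial a s ≈P monomial b s′
  monomial-cong {s = s} a≈b ≡.refl m with ≡-dec ℕ._≟_ s m
  ... | yes _ = +-congʳ a≈b
  ... | no  _ = refl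

  X : Monomial → Poly
  X = monomial 1#

  coeff-X* : ∀ s q m → coeff (X s *P q) m ≈ shifted s q m
  coeff-X* s q m = trans (coeff-∷* 1# s [] q m) (trans (+-identityʳ _) (*-identityˡ _))

  shifted-⊕ : ∀ s q m → shifted s q (s ⊕ m) ≈ coeff q m
  shifted-⊕ s q m with ≡-dec ℕ._≟_ (s ⊕ ((s ⊕ m) ⊖ s)) (s ⊕ m)
  ... | yes _ = reflexive (≡.cong (coeff q) (⊕-⊖ s m))
  ... | no ne = contradiction (≡.cong (s ⊕_) (⊕-⊖ s m)) ne

  *P-identityˡ : ∀ p → X 𝟘 *P p ≈P p
  *P-identityˡ p m = trans (coeff-X* 𝟘 p m) (trans
    (reflexive (≡.cong (shifted 𝟘 p) (≡.sym (⊕-identityˡ m)))) (shifted-⊕ 𝟘 p m))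

  -- A record and opaque operations, so that the polynomials of an equation can
  -- be inferred from its type.
  record _≃_ (p q : Poly) : Set ℓ where
    constructor by-coeff
    field coeff-≈ : p ≈P q
  open _≃_ public
  infix 4 _≃_

  opaque
    infixl 6 _⊞_
    infixl 7 _⊠_
    _⊞_ _⊠_ : Poly → Poly → Poly
    _⊞_ = _+P_
    _⊠_ = _*P_

    ⊟_ : Poly → Poly
    ⊟_ = -P_

  ≃-refl : ∀ {p} → p ≃ p
  ≃-refl = by-coeff λ m → refl
  ≃-sym : ∀ {p q} → p ≃ q → q ≃ p
  ≃-sym e = by-coeff λ m → sym (coeff-≈ e m)
  ≃-trans : ∀ {p q r} → p ≃ q → q ≃ r → p ≃ r
  ≃-trans e f = by-coeff λ m → trans (coeff-≈ e m) (coeff-≈ f m)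

  polySetoid : Setoid c ℓ
  polySetoid = record { Carrier = Poly ; _≈_ = _≃_
    ; isEquivalence = record { refl = ≃-refl ; sym = ≃-sym ; trans = ≃-trans } }

  opaque
    unfolding _⊞_

    ⊞≡+P : ∀ p q → p ⊞ q ≡ p +P q
    ⊞≡+P p q = ≡.refl

    ⊠≡*P : ∀ p q → p ⊠ q ≡ p *P q
    ⊠≡*P p q = ≡.refl

    ⊟≡-P : ∀ p → ⊟ p ≡ -P p
    ⊟≡-P p = ≡.refl

    ∷-⊞ : ∀ a s p → (a , s) ∷ p ≡ monomial a s ⊞ p
    ∷-⊞ a s p = ≡.refl

    ⊞-cong : ∀ {p p′ q q′} → p ≃ p′ → q ≃ q′ → p ⊞ q ≃ p′ ⊞ q′
    ⊞-cong {p} {p′} {q} {q′} e f = by-coeff (+P-cong {p} {p′} {q} {q′} (coeff-≈ e) (coeff-≈ f))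

    ⊞-comm : ∀ p q → p ⊞ q ≃ q ⊞ p
    ⊞-comm p q = by-coeff (+P-comm p q)

    ⊞-assoc : ∀ p q r → (p ⊞ q) ⊞ r ≃ p ⊞ (q ⊞ r)
    ⊞-assoc p q r = by-coeff (+P-assoc p q r)

    ⊞-identityˡ : ∀ p → 0P ⊞ p ≃ p
    ⊞-identityˡ p = ≃-refl

    ⊟-cong : ∀ {p q} → p ≃ q → ⊟ p ≃ ⊟ q
    ⊟-cong {p} {q} e = by-coeff (-P-cong {p} {q} (coeff-≈ e))

    ⊟-inverseʳ : ∀ p → p ⊞ ⊟ p ≃ 0P
    ⊟-inverseʳ p = by-coeff (-P-inverseʳ p)

    ⊠-congˡ : ∀ p {q r} → q ≃ r → p ⊠ q ≃ p ⊠ r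
    ⊠-congˡ p e = by-coeff (*P-congˡ p (coeff-≈ e))

    ⊠-distribˡ : ∀ p q r → p ⊠ (q ⊞ r) ≃ p ⊠ q ⊞ p ⊠ r
    ⊠-distribˡ p q r = by-coeff (distribˡP p q r)

    ⊠-distribʳ : ∀ r p q → (p ⊞ q) ⊠ r ≃ p ⊠ r ⊞ q ⊠ r
    ⊠-distribʳ r p q = by-coeff (distribʳP r p q)

    ⊠-zeroˡ : ∀ p → 0P ⊠ p ≃ 0P
    ⊠-zeroˡ p = ≃-refl

    ⊠-identityˡ : ∀ p → X 𝟘 ⊠ p ≃ p
    ⊠-identityˡ p = by-coeff (*P-identityˡ p)

    monomial-⊠ : ∀ a s b r → monomial a s ⊠ monomial b r ≡ monomial (a * b) (s ⊕ r)
    monomial-⊠ a s b r = ≡.refl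

    ⊠-zeroʳ : ∀ p → p ⊠ 0P ≃ 0P
    ⊠-zeroʳ []            = ≃-refl
    ⊠-zeroʳ ((a , s) ∷ p) = by-coeff (coeff-≈ (⊠-zeroʳ p))

  monomial-⊠-comm : ∀ a s q → monomial a s ⊠ q ≃ q ⊠ monomial a s
  monomial-⊠-comm a s []            = ≃-trans (⊠-zeroʳ _) (≃-sym (⊠-zeroˡ _))
  monomial-⊠-comm a s ((b , r) ∷ q) rewrite ∷-⊞ b r q = begin
    monomial a s ⊠ (monomial b r ⊞ q)                     ≈⟨ ⊠-distribˡ _ _ _ ⟩
    monomial a s ⊠ monomial b r ⊞ monomial a s ⊠ q        ≈⟨ ⊞-cong terms (monomial-⊠-comm a s q) ⟩
    monomial b r ⊠ monomial a s ⊞ q ⊠ monomial a s        ≈⟨ ⊠-distribʳ _ _ _ ⟨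
    (monomial b r ⊞ q) ⊠ monomial a s                     ∎
    where
    open SetoidReasoning polySetoid
    terms : monomial a s ⊠ monomial b r ≃ monomial b r ⊠ monomial a s
    terms rewrite monomial-⊠ a s b r | monomial-⊠ b r a s = by-coeff (monomial-cong (*-comm a b) (⊕-comm s r))

  ⊠-comm : ∀ p q → p ⊠ q ≃ q ⊠ p
  ⊠-comm []            q = ≃-trans (⊠-zeroˡ q) (≃-sym (⊠-zeroʳ q))
  ⊠-comm ((a , s) ∷ p) q rewrite ∷-⊞ a s p = begin
    (monomial a s ⊞ p) ⊠ q           ≈⟨ ⊠-distribʳ _ _ _ ⟩
    monomial a s ⊠ q ⊞ p ⊠ q         ≈⟨ ⊞-cong (monomial-⊠-comm a s q) (⊠-comm p q) ⟩
    q ⊠ monomial a s ⊞ q ⊠ p         ≈⟨ ⊠-distribˡ _ _ _ ⟨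
    q ⊠ (monomial a s ⊞ p)           ∎
    where open SetoidReasoning polySetoid

  ⊠-congʳ : ∀ r {p q} → p ≃ q → p ⊠ r ≃ q ⊠ r
  ⊠-congʳ r {p} {q} e = ≃-trans (⊠-comm p r) (≃-trans (⊠-congˡ r e) (⊠-comm r q))

  -- Associativity extends additively from monomials in each factor in turn.
  ⊠-assoc-monomial₂ : ∀ a s b t r → (monomial a s ⊠ monomial b t) ⊠ r ≃ monomial a s ⊠ (monomial b t ⊠ r)
  ⊠-assoc-monomial₂ a s b t []            =
    ≃-trans (⊠-zeroʳ _) (≃-sym (≃-trans (⊠-congˡ _ (⊠-zeroʳ _)) (⊠-zeroʳ _)))
  ⊠-assoc-monomial₂ a s b t ((d , u) ∷ r) rewrite ∷-⊞ d u r = begin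
    (x ⊠ y) ⊠ (monomial d u ⊞ r)                 ≈⟨ ⊠-distribˡ _ _ _ ⟩
    (x ⊠ y) ⊠ monomial d u ⊞ (x ⊠ y) ⊠ r         ≈⟨ ⊞-cong terms (⊠-assoc-monomial₂ a s b t r) ⟩
    x ⊠ (y ⊠ monomial d u) ⊞ x ⊠ (y ⊠ r)         ≈⟨ ⊠-distribˡ _ _ _ ⟨
    x ⊠ (y ⊠ monomial d u ⊞ y ⊠ r)               ≈⟨ ⊠-congˡ _ (⊠-distribˡ _ _ _) ⟨
    x ⊠ (y ⊠ (monomial d u ⊞ r))                 ∎
    where
    open SetoidReasoning polySetoid
    x = monomial a s
    y = monomial b t
    terms : (x ⊠ y) ⊠ monomial d u ≃ x ⊠ (y ⊠ monomial d u)
    terms rewrite monomial-⊠ a s b t | monomial-⊠ b t d u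
                | monomial-⊠ (a * b) (s ⊕ t) d u | monomial-⊠ a s (b * d) (t ⊕ u) =
      by-coeff (monomial-cong (*-assoc a b d) (⊕-assoc s t u))

  ⊠-assoc-monomial₁ : ∀ a s q r → (monomial a s ⊠ q) ⊠ r ≃ monomial a s ⊠ (q ⊠ r)
  ⊠-assoc-monomial₁ a s []            r = begin
    (x ⊠ 0P) ⊠ r   ≈⟨ ⊠-congʳ r (⊠-zeroʳ x) ⟩
    0P ⊠ r         ≈⟨ ⊠-zeroˡ r ⟩
    0P             ≈⟨ ⊠-zeroʳ x ⟨
    x ⊠ 0P         ≈⟨ ⊠-congˡ x (⊠-zeroˡ r) ⟨
    x ⊠ (0P ⊠ r)   ∎
    where
    open SetoidReasoning polySetoid
    x = monomial a s
  ⊠-assoc-monomial₁ a s ((b , t) ∷ q) r rewrite ∷-⊞ b t q = begin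
    (x ⊠ (y ⊞ q)) ⊠ r                ≈⟨ ⊠-congʳ r (⊠-distribˡ _ _ _) ⟩
    (x ⊠ y ⊞ x ⊠ q) ⊠ r              ≈⟨ ⊠-distribʳ _ _ _ ⟩
    (x ⊠ y) ⊠ r ⊞ (x ⊠ q) ⊠ r        ≈⟨ ⊞-cong (⊠-assoc-monomial₂ a s b t r) (⊠-assoc-monomial₁ a s q r) ⟩
    x ⊠ (y ⊠ r) ⊞ x ⊠ (q ⊠ r)        ≈⟨ ⊠-distribˡ _ _ _ ⟨
    x ⊠ (y ⊠ r ⊞ q ⊠ r)              ≈⟨ ⊠-congˡ x (⊠-distribʳ _ _ _) ⟨
    x ⊠ ((y ⊞ q) ⊠ r)                ∎
    where
    open SetoidReasoning polySetoid
    x = monomial a s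
    y = monomial b t

  ⊠-assoc : ∀ p q r → (p ⊠ q) ⊠ r ≃ p ⊠ (q ⊠ r)
  ⊠-assoc []            q r = begin
    (0P ⊠ q) ⊠ r   ≈⟨ ⊠-congʳ r (⊠-zeroˡ q) ⟩
    0P ⊠ r         ≈⟨ ⊠-zeroˡ r ⟩
    0P             ≈⟨ ⊠-zeroˡ (q ⊠ r) ⟨
    0P ⊠ (q ⊠ r)   ∎
    where open SetoidReasoning polySetoid
  ⊠-assoc ((a , s) ∷ p) q r rewrite ∷-⊞ a s p = begin
    ((x ⊞ p) ⊠ q) ⊠ r                ≈⟨ ⊠-congʳ r (⊠-distribʳ _ _ _) ⟩
    (x ⊠ q ⊞ p ⊠ q) ⊠ r              ≈⟨ ⊠-distribʳ _ _ _ ⟩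
    (x ⊠ q) ⊠ r ⊞ (p ⊠ q) ⊠ r        ≈⟨ ⊞-cong (⊠-assoc-monomial₁ a s q r) (⊠-assoc p q r) ⟩
    x ⊠ (q ⊠ r) ⊞ p ⊠ (q ⊠ r)        ≈⟨ ⊠-distribʳ _ _ _ ⟨
    (x ⊞ p) ⊠ (q ⊠ r)                ∎
    where
    open SetoidReasoning polySetoid
    x = monomial a s

  polyRing : CommutativeRing c ℓ
  polyRing = record
    { Carrier = Poly ; _≈_ = _≃_ ; _+_ = _⊞_ ; _*_ = _⊠_ ; -_ = ⊟_ ; 0# = 0P ; 1# = X 𝟘
    ; isCommutativeRing = record
      { isRing = record
        { +-isAbelianGroup = record
          { isGroup = record
            { isMonoid = record
              { isSemigroup = record
                { isMagma = record { isEquivalence = Setoid.isEquivalence polySetoid ; ∙-cong = ⊞-cong }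
                ; assoc = ⊞-assoc }
              ; identity = ⊞-identityˡ , λ p → ≃-trans (⊞-comm p 0P) (⊞-identityˡ p) }
            ; inverse = (λ p → ≃-trans (⊞-comm (⊟ p) p) (⊟-inverseʳ p)) , ⊟-inverseʳ
            ; ⁻¹-cong = ⊟-cong }
          ; comm = ⊞-comm }
        ; *-cong = λ {p} {p′} {q} e f → ≃-trans (⊠-congʳ q e) (⊠-congˡ p′ f)
        ; *-assoc = ⊠-assoc
        ; *-identity = ⊠-identityˡ , λ p → ≃-trans (⊠-comm p (X 𝟘)) (⊠-identityˡ p)
        ; distrib = ⊠-distribˡ , ⊠-distribʳ }
      ; *-comm = ⊠-comm } }

  X-⊕ : ∀ s r → X s ⊠ X r ≃ X (s ⊕ r)
  X-⊕ s r rewrite monomial-⊠ 1# s 1# r = by-coeff (monomial-cong {s = s ⊕ r} (*-identityˡ 1#) ≡.refl)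

  coeff-X⊠ : ∀ s q m → coeff (X s ⊠ q) m ≈ shifted s q m
  coeff-X⊠ s q m rewrite ⊠≡*P (X s) q = coeff-X* s q m

  X-cancel : ∀ s p → X s ⊠ p ≃ 0P → p ≃ 0P
  X-cancel s p Xp≃0 = by-coeff λ m → begin
    coeff p m                   ≈⟨ shifted-⊕ s p m ⟨
    shifted s p (s ⊕ m)         ≈⟨ coeff-X⊠ s p (s ⊕ m) ⟨
    coeff (X s ⊠ p) (s ⊕ m)    ≈⟨ coeff-≈ Xp≃0 (s ⊕ m) ⟩
    0#                          ∎
    where open SetoidReasoning setoid

  -- Division by a monomial

  -- Terms divisible by `x^s` are divided and all others dropped. Only exponents are compared, so no
  -- decision about coefficients in the field is made.
  quot : Monomial → Poly → Poly
  quot s [] = []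
  quot s ((a , m) ∷ p) with ≡-dec ℕ._≟_ (s ⊕ (m ⊖ s)) m
  ... | yes _ = (a , m ⊖ s) ∷ quot s p
  ... | no  _ = quot s p

  -- Although `quot` works on representing lists, this description depends only on coefficients;
  -- hence `quot` respects equality of polynomials.
  coeff-quot : ∀ s p m → coeff (quot s p) m ≈ coeff p (s ⊕ m)
  coeff-quot s []             m = refl
  coeff-quot s ((a , m′) ∷ p) m with ≡-dec ℕ._≟_ (s ⊕ (m′ ⊖ s)) m′ | ≡-dec ℕ._≟_ m′ (s ⊕ m)
  ... | no ne | yes eq = contradiction
    (≡.trans (≡.cong (λ z → s ⊕ (z ⊖ s)) eq) (≡.trans (≡.cong (s ⊕_) (⊕-⊖ s m)) (≡.sym eq))) ne
  ... | no _  | no _   = coeff-quot s p m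
  ... | yes eq | yes eq′ with ≡-dec ℕ._≟_ (m′ ⊖ s) m
  ...   | yes _ = +-congˡ (coeff-quot s p m)
  ...   | no ne = contradiction (≡.trans (≡.cong (_⊖ s) eq′) (⊕-⊖ s m)) ne
  coeff-quot s ((a , m′) ∷ p) m | yes eq | no ne with ≡-dec ℕ._≟_ (m′ ⊖ s) m
  ...   | yes e = contradiction (≡.trans (≡.sym eq) (≡.cong (s ⊕_) e)) ne
  ...   | no _  = coeff-quot s p m

  quot-cong : ∀ s {p q} → p ≃ q → quot s p ≃ quot s q
  quot-cong s {p} {q} e = by-coeff λ m →
    trans (coeff-quot s p m) (trans (coeff-≈ e (s ⊕ m)) (sym (coeff-quot s q m)))

  quot-⊞ : ∀ s p q → quot s (p ⊞ q) ≃ quot s p ⊞ quot s q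
  quot-⊞ s p q rewrite ⊞≡+P p q | ⊞≡+P (quot s p) (quot s q) = by-coeff λ m → begin
    coeff (quot s (p ++ q)) m                     ≈⟨ coeff-quot s (p ++ q) m ⟩
    coeff (p ++ q) (s ⊕ m)                        ≈⟨ coeff-++ p q (s ⊕ m) ⟩
    coeff p (s ⊕ m) + coeff q (s ⊕ m)             ≈⟨ +-cong (coeff-quot s p m) (coeff-quot s q m) ⟨
    coeff (quot s p) m + coeff (quot s q) m       ≈⟨ coeff-++ (quot s p) (quot s q) m ⟨
    coeff (quot s p ++ quot s q) m                ∎
    where open SetoidReasoning setoid

  quot-X : ∀ s p → quot s (X s ⊠ p) ≃ p
  quot-X s p = by-coeff λ m → trans (coeff-quot s (X s ⊠ p) m) (trans (coeff-X⊠ s p (s ⊕ m)) (shifted-⊕ s p m))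

  -- For coprime monomials, `x^r` divides `x^s x^m` exactly when it divides `x^m`: the two tests
  -- differ by adding `s` on both sides, which cancels.
  shifted-disjoint : ∀ s r p m → Disjoint s r → shifted r p (s ⊕ m) ≈ shifted r (quot s p) m
  shifted-disjoint s r p m d
    with ≡-dec ℕ._≟_ (r ⊕ ((s ⊕ m) ⊖ r)) (s ⊕ m) | ≡-dec ℕ._≟_ (r ⊕ (m ⊖ r)) m
  ... | no _   | no _   = refl
  ... | yes _  | yes _  = trans (reflexive (≡.cong (coeff p) (⊕-⊖-disjoint s r m d))) (sym (coeff-quot s p (m ⊖ r)))
  ... | yes eq | no ne  = contradiction (⊕-cancelˡ s (≡.trans (≡.sym (⊕-⊖-swap s r m d)) eq)) ne
  ... | no ne  | yes eq = contradiction (≡.trans (⊕-⊖-swap s r m d) (≡.cong (s ⊕_) eq)) ne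

  quot-X-disjoint : ∀ s r p → Disjoint s r → quot s (X r ⊠ p) ≃ X r ⊠ quot s p
  quot-X-disjoint s r p d = by-coeff λ m → begin
    coeff (quot s (X r ⊠ p)) m   ≈⟨ coeff-quot s (X r ⊠ p) m ⟩
    coeff (X r ⊠ p) (s ⊕ m)      ≈⟨ coeff-X⊠ r p (s ⊕ m) ⟩
    shifted r p (s ⊕ m)           ≈⟨ shifted-disjoint s r p m d ⟩
    shifted r (quot s p) m        ≈⟨ coeff-X⊠ r (quot s p) m ⟨
    coeff (X r ⊠ quot s p) m     ∎
    where open SetoidReasoning setoid

  In𝔪-cong : ∀ {p q} → p ≃ q → In𝔪 p → In𝔪 q
  In𝔪-cong e h = trans (sym (coeff-≈ e 𝟘)) h

  In𝔪-⊞ : ∀ {p q} → In𝔪 p → In𝔪 q → In𝔪 (p ⊞ q)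
  In𝔪-⊞ {p} {q} h k rewrite ⊞≡+P p q = trans (coeff-++ p q 𝟘) (trans (+-cong h k) (+-identityˡ 0#))

  In𝔪-⊟ : ∀ {p} → In𝔪 p → In𝔪 (⊟ p)
  In𝔪-⊟ {p} h rewrite ⊟≡-P p = trans (coeff-neg p 𝟘) (trans (-‿cong h) -0#≈0#)
    where open RingProperties ring using (-0#≈0#)

  In𝔪-X : ∀ s p → s ≢ 𝟘 → In𝔪 (X s ⊠ p)
  In𝔪-X s p s≢𝟘 = trans (coeff-X⊠ s p 𝟘) vanish
    where
    vanish : shifted s p 𝟘 ≈ 0#
    vanish with ≡-dec ℕ._≟_ (s ⊕ (𝟘 ⊖ s)) 𝟘
    ... | yes eq = contradiction (⊕-zeroˡ s _ eq) s≢𝟘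
    ... | no _   = refl

-- Linear maps, syzygies of one cycle, and resolutions over a commutative ring

module Complexes {c ℓ : Level} (R : CommutativeRing c ℓ) where
  open CommutativeRing R hiding (zero)
  open SemiringSum semiring public using (sum; sum-cong-≋; ∑-distrib-+; *-distribˡ-sum; sum-remove; sum-replicate-zero)
  open RingProperties ring
  open SetoidReasoning setoid

  record Linear {A : Set} (f : (A → Carrier) → Carrier) : Set (c ⊔ ℓ) where
    field
      cong   : ∀ {u v} → (∀ a → u a ≈ v a) → f u ≈ f v
      +-homo : ∀ u v → f (λ a → u a + v a) ≈ f u + f v
      *-homo : ∀ r u → f (λ a → r * u a) ≈ r * f u

    0-homo : f (λ _ → 0#) ≈ 0#
    0-homo = begin
      f (λ _ → 0#)          ≈⟨ cong (λ _ → sym (zeroˡ 0#)) ⟩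
      f (λ _ → 0# * 0#)     ≈⟨ *-homo 0# _ ⟩
      0# * f (λ _ → 0#)     ≈⟨ zeroˡ _ ⟩
      0#                    ∎

    neg-homo : ∀ u → f (λ a → - u a) ≈ - f u
    neg-homo u = begin
      f (λ a → - u a)          ≈⟨ cong (λ a → sym (-1*x≈-x (u a))) ⟩
      f (λ a → - 1# * u a)     ≈⟨ *-homo _ u ⟩
      - 1# * f u               ≈⟨ -1*x≈-x _ ⟩
      - f u                    ∎

    sum-homo : ∀ {n} (u : Fin n → A → Carrier) → f (λ a → sum (λ i → u i a)) ≈ sum (λ i → f (u i))
    sum-homo {zero}  u = 0-homo
    sum-homo {suc n} u = trans (+-homo _ _) (+-congˡ (sum-homo (u ∘ suc)))

  -- Partial division and its remainder preserve sums but not multiplication by ring elements, so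
  -- `Linear` would be too strong for them.
  record Additive (s : Carrier → Carrier) : Set (c ⊔ ℓ) where
    field
      cong   : ∀ {p q} → p ≈ q → s p ≈ s q
      +-homo : ∀ p q → s (p + q) ≈ s p + s q

    0-homo : s 0# ≈ 0#
    0-homo = +-identityʳ-unique (s 0#) (s 0#) (trans (sym (+-homo 0# 0#)) (cong (+-identityˡ 0#)))

    sum-homo : ∀ {n} (u : Fin n → Carrier) → s (sum u) ≈ sum (s ∘ u)
    sum-homo {zero}  u = 0-homo
    sum-homo {suc n} u = trans (+-homo _ _) (+-congˡ (sum-homo (u ∘ suc)))

  CommutesWith : {A : Set} → (Carrier → Carrier) → ((A → Carrier) → Carrier) → Set (c ⊔ ℓ)
  CommutesWith s f = ∀ v → s (f v) ≈ f (s ∘ v)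

  record IsSubgroup (𝔪 : Carrier → Set ℓ) : Set (c ⊔ ℓ) where
    field
      0-closed   : 𝔪 0#
      +-closed   : ∀ {p q} → 𝔪 p → 𝔪 q → 𝔪 (p + q)
      neg-closed : ∀ {p} → 𝔪 p → 𝔪 (- p)

  -- The variables x_j of a cycle, the products g_j of the other variables of
  -- that cycle, and partial division by x_j.
  record Factor (𝔪 : Carrier → Set ℓ) (m : ℕ) : Set (c ⊔ ℓ) where
    field
      x g       : Fin (suc m) → Carrier
      div       : Fin (suc m) → Carrier → Carrier
      div-additive : ∀ j → Additive (div j)
      div-x     : ∀ j p → div j (x j * p) ≈ p
      div-g     : ∀ j p → div j (g j * p) ≈ g j * div j p
      x∣g       : ∀ {i j} → i ≢ j → ∃[ h ] (g i ≈ x j * h)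
      g-cancel  : ∀ j {p} → g j * p ≈ 0# → p ≈ 0#
      x*g-const : ∀ i j → x i * g i ≈ x j * g j
      x∈𝔪       : ∀ j p → 𝔪 (x j * p)

    module _ (j : Fin (suc m)) where
      open Additive (div-additive j) public using () renaming (cong to div-cong; +-homo to div-+; 0-homo to div-0)

    x-cancel : ∀ j {p} → x j * p ≈ 0# → p ≈ 0#
    x-cancel j {p} xp≈0 = begin
      p                    ≈⟨ div-x j p ⟨
      div j (x j * p)      ≈⟨ div-cong j xp≈0 ⟩
      div j 0#             ≈⟨ div-0 j ⟩
      0#                   ∎

    -- Stands in for reduction modulo `x j`, as an additive endomorphism of the ring itself: it
    -- kills the multiples of `x j` and commutes with multiplication by `g j`.
    rem : Fin (suc m) → Carrier → Carrier
    rem j p = p - x j * div j p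

    rem-cong : ∀ j {p q} → p ≈ q → rem j p ≈ rem j q
    rem-cong j p≈q = +-cong p≈q (-‿cong (*-congˡ (div-cong j p≈q)))

    rem-additive : ∀ j → Additive (rem j)
    rem-additive j = record { cong = rem-cong j ; +-homo = λ p q → begin
      (p + q) - x j * div j (p + q)                          ≈⟨ +-congˡ (-‿cong (trans (*-congˡ (div-+ j p q)) (distribˡ _ _ _))) ⟩
      (p + q) - (x j * div j p + x j * div j q)              ≈⟨ +-congˡ (-‿+-comm _ _) ⟨
      (p + q) + (- (x j * div j p) + - (x j * div j q))      ≈⟨ interchange _ _ _ _ ⟩
      rem j p + rem j q                                      ∎ }
      where open CommutativeSemigroupProperties +-commutativeSemigroup using (interchange)

    rem-x : ∀ j p → rem j (x j * p) ≈ 0#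
    rem-x j p = trans (+-congˡ (-‿cong (*-congˡ (div-x j p)))) (-‿inverseʳ _)

    rem-g : ∀ j p → rem j (g j * p) ≈ g j * rem j p
    rem-g j p = begin
      g j * p - x j * div j (g j * p)      ≈⟨ +-congˡ (-‿cong (*-congˡ (div-g j p))) ⟩
      g j * p - x j * (g j * div j p)      ≈⟨ +-congˡ (-‿cong (x∙yz≈y∙xz _ _ _)) ⟩
      g j * p - g j * (x j * div j p)      ≈⟨ +-congˡ (-‿distribʳ-* _ _) ⟩
      g j * p + g j * - (x j * div j p)    ≈⟨ distribˡ _ _ _ ⟨
      g j * rem j p                        ∎
      where open CommutativeSemigroupProperties *-commutativeSemigroup using (x∙yz≈y∙xz)

    -- Modulo x_j every summand except the j-th vanishes.
    syzygy : ∀ (v : Fin (suc m) → Carrier) → sum (λ i → g i * v i) ≈ 0# → ∀ j → v j ≈ x j * div j (v j)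
    syzygy v Σ≈0 j = x-y≈0⇒x≈y _ _ (g-cancel j (begin
      g j * rem j (v j)
        ≈⟨ rem-g j (v j) ⟨
      rem j (g j * v j)
        ≈⟨ +-identityʳ _ ⟨
      rem j (g j * v j) + 0#
        ≈⟨ +-congˡ (trans (sum-cong-≋ {n = m} (λ k → others (punchIn j k) (punchInᵢ≢i j k))) (sum-replicate-zero m)) ⟨
      rem j (g j * v j) + sum (λ k → rem j (g (punchIn j k) * v (punchIn j k)))
        ≈⟨ sum-remove {i = j} (λ i → rem j (g i * v i)) ⟨
      sum (λ i → rem j (g i * v i))
        ≈⟨ Additive.sum-homo (rem-additive j) (λ i → g i * v i) ⟨
      rem j (sum (λ i → g i * v i))
        ≈⟨ rem-cong j Σ≈0 ⟩
      rem j 0#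
        ≈⟨ Additive.0-homo (rem-additive j) ⟩
      0# ∎))
      where
      others : ∀ i → i ≢ j → rem j (g i * v i) ≈ 0#
      others i i≢j with x∣g i≢j
      ... | h , g≈ = trans (rem-cong j (trans (*-congʳ g≈) (*-assoc _ _ _))) (rem-x j _)
      x-y≈0⇒x≈y : ∀ a b → a - b ≈ 0# → a ≈ b
      x-y≈0⇒x≈y a b e = trans (+-inverseˡ-unique a (- b) e) (-‿involutive b)

    -- All the products `x i * g i` are the same element, so this element times the sum of the
    -- quotients is `Σ g i * v i`, which is zero; its two factors are then cancelled.
    syzygy-sum : ∀ (v : Fin (suc m) → Carrier) → sum (λ i → g i * v i) ≈ 0# → sum (λ i → div i (v i)) ≈ 0#
    syzygy-sum v Σ≈0 = x-cancel zero (g-cancel zero (begin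
      g zero * (x zero * sum (λ i → div i (v i)))    ≈⟨ *-assoc _ _ _ ⟨
      g zero * x zero * sum (λ i → div i (v i))      ≈⟨ *-distribˡ-sum _ (λ i → div i (v i)) ⟩
      sum (λ i → g zero * x zero * div i (v i))      ≈⟨ sum-cong-≋ term ⟩
      sum (λ i → g i * v i)                          ≈⟨ Σ≈0 ⟩
      0#                                             ∎))
      where
      term : ∀ i → g zero * x zero * div i (v i) ≈ g i * v i
      term i = begin
        g zero * x zero * div i (v i)      ≈⟨ *-congʳ (trans (*-comm _ _) (trans (x*g-const zero i) (*-comm _ _))) ⟩
        g i * x i * div i (v i)            ≈⟨ *-assoc _ _ _ ⟩
        g i * (x i * div i (v i))          ≈⟨ *-congˡ (syzygy v Σ≈0 i) ⟨
        g i * v i                          ∎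

    -- The kernel of (v_j) ↦ Σ g_j v_j, parametrised: v_j = x_j u_j with Σ u_j = 0.
    φ : (Fin m → Carrier) → Fin (suc m) → Carrier
    φ b zero    = - (x zero * sum b)
    φ b (suc j) = x (suc j) * b j

    φ-cong : ∀ {b b′ : Fin m → Carrier} → (∀ j → b j ≈ b′ j) → ∀ i → φ b i ≈ φ b′ i
    φ-cong e zero    = -‿cong (*-congˡ (sum-cong-≋ e))
    φ-cong e (suc j) = *-congˡ (e j)

    -- A matrix of scalars commutes with a linear map applied to each block. Taken for `∂`, this
    -- makes `φ` a chain map; taken for `aug`, it makes `φ` compatible with the augmentation.
    φ-linear : ∀ {A : Set} {f : (A → Carrier) → Carrier} → Linear f → ∀ (b : Fin m → A → Carrier) i →
               f (λ a → φ (λ j → b j a) i) ≈ φ (λ j → f (b j)) i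
    φ-linear lin b zero    = trans (Linear.neg-homo lin _) (-‿cong (trans (Linear.*-homo lin _ _) (*-congˡ (Linear.sum-homo lin b))))
    φ-linear lin b (suc j) = Linear.*-homo lin _ _

    φ-linear′ : ∀ (i : Fin (suc m)) → Linear (λ b → φ b i)
    φ-linear′ zero = record
      { cong = λ e → φ-cong e zero
      ; +-homo = λ u v → trans (-‿cong (trans (*-congˡ (∑-distrib-+ u v)) (distribˡ _ _ _))) (sym (-‿+-comm _ _))
      ; *-homo = λ r u → trans (-‿cong (trans (*-congˡ (sym (*-distribˡ-sum r u))) (x∙yz≈y∙xz _ _ _))) (-‿distribʳ-* _ _) }
      where open CommutativeSemigroupProperties *-commutativeSemigroup using (x∙yz≈y∙xz)
    φ-linear′ (suc j) = record
      { cong = λ e → *-congˡ (e j) ; +-homo = λ u v → distribˡ _ _ _ ; *-homo = λ r u → x∙yz≈y∙xz _ _ _ }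
      where open CommutativeSemigroupProperties *-commutativeSemigroup using (x∙yz≈y∙xz)

    φ-neg : ∀ (b : Fin m → Carrier) i → φ (λ j → - b j) i ≈ - φ b i
    φ-neg b i = Linear.neg-homo (φ-linear′ i) b

    g∙φ : ∀ (b : Fin m → Carrier) → sum (λ i → g i * φ b i) ≈ 0#
    g∙φ b = begin
      g zero * - (x zero * sum b) + sum (λ j → g (suc j) * (x (suc j) * b j))
        ≈⟨ +-cong (trans (sym (-‿distribʳ-* _ _)) (-‿cong (sym (*-assoc _ _ _)))) (sum-cong-≋ term) ⟩
      - (g zero * x zero * sum b) + sum (λ j → g zero * x zero * b j)
        ≈⟨ +-congˡ (*-distribˡ-sum _ b) ⟨
      - (g zero * x zero * sum b) + g zero * x zero * sum b
        ≈⟨ -‿inverseˡ _ ⟩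
      0# ∎
      where
      term : ∀ j → g (suc j) * (x (suc j) * b j) ≈ g zero * x zero * b j
      term j = trans (sym (*-assoc _ _ _)) (*-congʳ (trans (*-comm _ _) (trans (x*g-const (suc j) zero) (*-comm _ _))))

    -- The quotients sum to zero, so the one at `zero` is minus the sum of the others. This leaves
    -- `m` free parameters for `suc m` generators.
    φ-syzygy : ∀ (v : Fin (suc m) → Carrier) → sum (λ i → g i * v i) ≈ 0# → ∀ i → v i ≈ φ (λ j → div (suc j) (v (suc j))) i
    φ-syzygy v Σ≈0 (suc j) = syzygy v Σ≈0 (suc j)
    φ-syzygy v Σ≈0 zero    = begin
      v zero                           ≈⟨ syzygy v Σ≈0 zero ⟩
      x zero * div zero (v zero)       ≈⟨ *-congˡ (+-inverseˡ-unique _ rest (syzygy-sum v Σ≈0)) ⟩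
      x zero * - rest                  ≈⟨ -‿distribʳ-* _ _ ⟨
      - (x zero * rest)                ∎
      where rest = sum (λ j → div (suc j) (v (suc j)))

  -- Unbounded, and with index types instead of ranks, so that the cone can use products and sums of
  -- types directly. The length is recovered later from the degrees with empty index type. Exactness
  -- in degree 0 is separate because `aug` takes a single value in the ring.
  record Resolution (𝔪 : Carrier → Set ℓ) : Set (c ⊔ lsuc Level.zero ⊔ ℓ) where
    field
      Index      : ℕ → Set
      aug        : (Index 0 → Carrier) → Carrier
      ∂          : ∀ k → (Index (suc k) → Carrier) → Index k → Carrier
      aug-linear : Linear aug
      ∂-linear   : ∀ k i → Linear (λ v → ∂ k v i)
      aug-∂      : ∀ v → aug (∂ 0 v) ≈ 0#
      ∂-∂        : ∀ k v i → ∂ k (∂ (suc k) v) i ≈ 0#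
      exact₀     : ∀ v → aug v ≈ 0# → ∃[ w ] (∀ i → ∂ 0 w i ≈ v i)
      exact₊     : ∀ k v → (∀ i → ∂ k v i ≈ 0#) → ∃[ w ] (∀ i → ∂ (suc k) w i ≈ v i)
      minimal    : ∀ k v i → 𝔪 (∂ k v i)

  module _ {𝔪 : Carrier → Set ℓ} (𝔪-subgroup : IsSubgroup 𝔪) where

    -- The base of the iteration, where no cycle has been used: a principal ideal generated by a
    -- nonzerodivisor is free.
    principal : ∀ μ → (∀ {p} → μ * p ≈ 0# → p ≈ 0#) → Resolution 𝔪
    principal μ μ-cancel = record
      { Index = λ { zero → ⊤ ; (suc k) → ⊥ }
      ; aug = λ v → μ * v tt
      ; ∂ = λ _ _ _ → 0#
      ; aug-linear = record { cong = λ e → *-congˡ (e tt) ; +-homo = λ u v → distribˡ _ _ _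
                            ; *-homo = λ r u → x∙yz≈y∙xz _ _ _ }
      ; ∂-linear = λ k i → record { cong = λ _ → refl ; +-homo = λ _ _ → sym (+-identityˡ 0#)
                                  ; *-homo = λ r u → sym (zeroʳ r) }
      ; aug-∂ = λ v → zeroʳ μ
      ; ∂-∂ = λ k v i → refl
      ; exact₀ = λ v e → (λ ()) , λ _ → sym (μ-cancel e)
      ; exact₊ = λ k v e → (λ ()) , λ ()
      ; minimal = λ k v i → IsSubgroup.0-closed 𝔪-subgroup }
      where open CommutativeSemigroupProperties *-commutativeSemigroup using (x∙yz≈y∙xz)

    -- The mapping cone that multiplies an ideal by one cycle ideal

    -- `div-aug` is the form in which the `x j` are nonzerodivisors modulo the ideal: the quotient
    -- of an element `aug v` is again a value of `aug`, with coefficients obtained by dividing those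
    -- of `v`.
    module Cone {m : ℕ} (F : Factor 𝔪 m) (C : Resolution 𝔪)
                (div-aug : ∀ j → CommutesWith (Factor.div F j) (Resolution.aug C)) where
      open Factor F
      open Resolution C

      Index′ : ℕ → Set
      Index′ zero    = Fin (suc m) × Index zero
      Index′ (suc k) = Fin (suc m) × Index (suc k) ⊎ Fin m × Index k

      upper : ∀ k → (Index′ (suc k) → Carrier) → Fin (suc m) → Index k → Carrier
      upper k v j i = ∂ k (λ i′ → v (inj₁ (j , i′))) i + φ (λ j′ → v (inj₂ (j′ , i))) j

      aug′ : (Index′ 0 → Carrier) → Carrier
      aug′ v = sum (λ j → g j * aug (λ i → v (j , i)))

      ∂′ : ∀ k → (Index′ (suc k) → Carrier) → Index′ k → Carrier
      ∂′ zero    v (j , i)        = upper zero v j i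
      ∂′ (suc k) v (inj₁ (j , i)) = upper (suc k) v j i
      -- The sign makes the two contributions of `φ` to the square of `∂′` cancel.
      ∂′ (suc k) v (inj₂ (j , i)) = - ∂ k (λ i′ → v (inj₂ (j , i′))) i

      private
        module aug = Linear aug-linear
        module ∂ k i = Linear (∂-linear k i)
        open CommutativeSemigroupProperties +-commutativeSemigroup using (interchange)
        open CommutativeSemigroupProperties *-commutativeSemigroup using (x∙yz≈y∙xz)

      aug′-linear : Linear aug′
      aug′-linear = record
        { cong   = λ e → sum-cong-≋ {n = suc m} (λ j → *-congˡ {g j} (aug.cong (λ i → e (j , i))))
        ; +-homo = λ u v → trans (sum-cong-≋ {n = suc m} (λ j → trans (*-congˡ {g j} (aug.+-homo (λ i → u (j , i)) (λ i → v (j , i)))) (distribˡ _ _ _)))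
                                 (∑-distrib-+ {n = suc m} (λ j → g j * aug (λ i → u (j , i))) (λ j → g j * aug (λ i → v (j , i))))
        ; *-homo = λ r u → trans (sum-cong-≋ {n = suc m} (λ j → trans (*-congˡ {g j} (aug.*-homo r (λ i → u (j , i)))) (x∙yz≈y∙xz _ _ _)))
                                 (sym (*-distribˡ-sum {n = suc m} r (λ j → g j * aug (λ i → u (j , i))))) }

      upper-linear : ∀ k j i → Linear (λ v → upper k v j i)
      upper-linear k j i = record
        { cong   = λ e → +-cong (∂.cong k i (λ i′ → e _)) (φ-cong (λ j′ → e _) j)
        ; +-homo = λ u v → trans (+-cong (∂.+-homo k i _ _) (Linear.+-homo (φ-linear′ j) _ _)) (interchange _ _ _ _)
        ; *-homo = λ r u → trans (+-cong (∂.*-homo k i _ _) (Linear.*-homo (φ-linear′ j) _ _)) (sym (distribˡ _ _ _)) }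

      ∂′-linear : ∀ k i → Linear (λ v → ∂′ k v i)
      ∂′-linear zero    (j , i)        = upper-linear zero j i
      ∂′-linear (suc k) (inj₁ (j , i)) = upper-linear (suc k) j i
      ∂′-linear (suc k) (inj₂ (j , i)) = record
        { cong   = λ e → -‿cong (∂.cong k i (λ i′ → e _))
        ; +-homo = λ u v → trans (-‿cong (∂.+-homo k i _ _)) (sym (-‿+-comm _ _))
        ; *-homo = λ r u → trans (-‿cong (∂.*-homo k i _ _)) (-‿distribʳ-* _ _) }

      aug-upper : ∀ v j → aug (upper 0 v j) ≈ φ (λ j′ → aug (λ i → v (inj₂ (j′ , i)))) j
      aug-upper v j = begin
        aug (upper 0 v j)
          ≈⟨ aug.+-homo _ _ ⟩
        aug (∂ 0 (λ i′ → v (inj₁ (j , i′)))) + aug (λ i → φ (λ j′ → v (inj₂ (j′ , i))) j)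
          ≈⟨ +-cong (aug-∂ _) (φ-linear aug-linear (λ j′ i → v (inj₂ (j′ , i))) j) ⟩
        0# + φ (λ j′ → aug (λ i → v (inj₂ (j′ , i)))) j
          ≈⟨ +-identityˡ _ ⟩
        φ (λ j′ → aug (λ i → v (inj₂ (j′ , i)))) j ∎

      ∂-upper : ∀ k v j i → ∂ k (upper (suc k) v j) i ≈ φ (λ j′ → ∂ k (λ i → v (inj₂ (j′ , i))) i) j
      ∂-upper k v j i = begin
        ∂ k (upper (suc k) v j) i
          ≈⟨ ∂.+-homo k i _ _ ⟩
        ∂ k (∂ (suc k) (λ i′ → v (inj₁ (j , i′)))) i + ∂ k (λ i → φ (λ j′ → v (inj₂ (j′ , i))) j) i
          ≈⟨ +-cong (∂-∂ k _ i) (φ-linear (∂-linear k i) (λ j′ i → v (inj₂ (j′ , i))) j) ⟩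
        0# + φ (λ j′ → ∂ k (λ i → v (inj₂ (j′ , i))) i) j
          ≈⟨ +-identityˡ _ ⟩
        φ (λ j′ → ∂ k (λ i → v (inj₂ (j′ , i))) i) j ∎

      aug′-∂′ : ∀ v → aug′ (∂′ 0 v) ≈ 0#
      aug′-∂′ v = trans (sum-cong-≋ {n = suc m} (λ j → *-congˡ {g j} (aug-upper v j))) (g∙φ (λ j′ → aug (λ i → v (inj₂ (j′ , i)))))

      upper-∂′ : ∀ k v j i → upper k (∂′ (suc k) v) j i ≈ 0#
      upper-∂′ k v j i = begin
        ∂ k (upper (suc k) v j) i + φ (λ j′ → - ∂ k (λ i → v (inj₂ (j′ , i))) i) j
          ≈⟨ +-cong (∂-upper k v j i) (φ-neg _ j) ⟩
        φ (λ j′ → ∂ k (λ i → v (inj₂ (j′ , i))) i) j - φ (λ j′ → ∂ k (λ i → v (inj₂ (j′ , i))) i) j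
          ≈⟨ -‿inverseʳ _ ⟩
        0# ∎

      ∂′-∂′ : ∀ k v i → ∂′ k (∂′ (suc k) v) i ≈ 0#
      ∂′-∂′ zero    v (j , i)        = upper-∂′ zero v j i
      ∂′-∂′ (suc k) v (inj₁ (j , i)) = upper-∂′ (suc k) v j i
      ∂′-∂′ (suc k) v (inj₂ (j , i)) = begin
        - ∂ k (λ i′ → - ∂ (suc k) (λ i″ → v (inj₂ (j , i″))) i′) i    ≈⟨ -‿cong (∂.neg-homo k i _) ⟩
        - - ∂ k (∂ (suc k) (λ i″ → v (inj₂ (j , i″)))) i              ≈⟨ -‿involutive _ ⟩
        ∂ k (∂ (suc k) (λ i″ → v (inj₂ (j , i″)))) i                  ≈⟨ ∂-∂ k _ i ⟩
        0#                                                            ∎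

      private
        cancel-sum : ∀ {a b c} → a ≈ b - c → a + c ≈ b
        cancel-sum {a} {b} {c} e = begin
          a + c           ≈⟨ +-congʳ e ⟩
          b - c + c       ≈⟨ +-assoc _ _ _ ⟩
          b + (- c + c)   ≈⟨ +-congˡ (-‿inverseˡ c) ⟩
          b + 0#          ≈⟨ +-identityʳ b ⟩
          b               ∎

      -- The blocks of `v` have augmentations that form a syzygy of the `g j`. Its parameters are
      -- quotients, which `div-aug` lifts to the vectors `b`; subtracting `φ b` leaves blocks killed
      -- by `aug`, to which exactness of the given resolution applies.
      exact₀′ : ∀ v → aug′ v ≈ 0# → ∃[ w ] (∀ i → ∂′ 0 w i ≈ v i)
      exact₀′ v Σ≈0 = w , λ { (j , i) → cancel-sum (proj₂ (lift j) i) }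
        where
        b : Fin m → Index 0 → Carrier
        b j i = div (suc j) (v (suc j , i))
        kernel : ∀ j → aug (λ i → v (j , i) - φ (λ j′ → b j′ i) j) ≈ 0#
        kernel j = begin
          aug (λ i → v (j , i) - φ (λ j′ → b j′ i) j)
            ≈⟨ trans (aug.+-homo _ _) (+-congˡ (aug.neg-homo _)) ⟩
          aug (λ i → v (j , i)) - aug (λ i → φ (λ j′ → b j′ i) j)
            ≈⟨ +-cong (φ-syzygy (λ j → aug (λ i → v (j , i))) Σ≈0 j) (-‿cong (φ-linear aug-linear b j)) ⟩
          φ (λ j′ → div (suc j′) (aug (λ i → v (suc j′ , i)))) j - φ (λ j′ → aug (b j′)) j
            ≈⟨ +-congʳ (φ-cong (λ j′ → div-aug (suc j′) _) j) ⟩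
          φ (λ j′ → aug (b j′)) j - φ (λ j′ → aug (b j′)) j
            ≈⟨ -‿inverseʳ _ ⟩
          0# ∎
        lift : ∀ j → ∃[ c ] (∀ i → ∂ 0 c i ≈ v (j , i) - φ (λ j′ → b j′ i) j)
        lift j = exact₀ _ (kernel j)
        w : Index′ 1 → Carrier
        w (inj₁ (j , i)) = proj₁ (lift j) i
        w (inj₂ (j , i)) = b j i

      -- Once the lower block is the negated boundary of `e`, subtracting `φ e` turns the upper
      -- block into a cycle, which can be lifted. The origin of `e` differs between degree one and
      -- the higher degrees, so it is a parameter.
      exact-from : ∀ k v (e : Fin m → Index (suc k) → Carrier) →
                   (∀ j i → ∂ k (e j) i ≈ - v (inj₂ (j , i))) →
                   (∀ j i → upper k v j i ≈ 0#) →
                   ∃[ w ] (∀ i → ∂′ (suc k) w i ≈ v i)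
      exact-from k v e ∂e≈ upper≈0 = w , λ
        { (inj₁ (j , i)) → cancel-sum (proj₂ (lift j) i)
        ; (inj₂ (j , i)) → trans (-‿cong (∂e≈ j i)) (-‿involutive _) }
        where
        kernel : ∀ j i → ∂ k (λ i → v (inj₁ (j , i)) - φ (λ j′ → e j′ i) j) i ≈ 0#
        kernel j i = begin
          ∂ k (λ i → v (inj₁ (j , i)) - φ (λ j′ → e j′ i) j) i
            ≈⟨ trans (∂.+-homo k i _ _) (+-congˡ (∂.neg-homo k i _)) ⟩
          ∂ k (λ i → v (inj₁ (j , i))) i - ∂ k (λ i → φ (λ j′ → e j′ i) j) i
            ≈⟨ +-congˡ (-‿cong (trans (φ-linear (∂-linear k i) e j) (trans (φ-cong (λ j′ → ∂e≈ j′ i) j) (φ-neg _ j)))) ⟩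
          ∂ k (λ i → v (inj₁ (j , i))) i - - φ (λ j′ → v (inj₂ (j′ , i))) j
            ≈⟨ +-congˡ (-‿involutive _) ⟩
          upper k v j i
            ≈⟨ upper≈0 j i ⟩
          0# ∎
        lift : ∀ j → ∃[ c ] (∀ i → ∂ (suc k) c i ≈ v (inj₁ (j , i)) - φ (λ j′ → e j′ i) j)
        lift j = exact₊ k _ (kernel j)
        w : Index′ (suc (suc k)) → Carrier
        w (inj₁ (j , i)) = proj₁ (lift j) i
        w (inj₂ (j , i)) = e j i

      exact₊′ : ∀ k v → (∀ i → ∂′ k v i ≈ 0#) → ∃[ w ] (∀ i → ∂′ (suc k) w i ≈ v i)
      exact₊′ zero v ∂v≈0 =
        exact-from zero v (λ j → proj₁ (pre j)) (λ j → proj₂ (pre j)) (λ j i → ∂v≈0 (j , i))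
        where
        b : Fin m → Index 0 → Carrier
        b j i = v (inj₂ (j , i))
        -- In degree one, `∂′` has no lower component that would state this. It follows from the
        -- upper one: applying `aug` to block `suc j` leaves `x (suc j) * aug (b j)`, and
        -- `x (suc j)` cancels.
        aug-b : ∀ j → aug (b j) ≈ 0#
        aug-b j = x-cancel (suc j) (trans (sym (aug-upper v (suc j)))
          (trans (aug.cong (λ i → ∂v≈0 (suc j , i))) aug.0-homo))
        pre : ∀ j → ∃[ e ] (∀ i → ∂ 0 e i ≈ - b j i)
        pre j = exact₀ _ (trans (aug.neg-homo _) (trans (-‿cong (aug-b j)) -0#≈0#))
      exact₊′ (suc k) v ∂v≈0 =
        exact-from (suc k) v (λ j → proj₁ (pre j)) (λ j → proj₂ (pre j)) (λ j i → ∂v≈0 (inj₁ (j , i)))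
        where
        pre : ∀ j → ∃[ e ] (∀ i → ∂ (suc k) e i ≈ - v (inj₂ (j , i)))
        pre j = exact₊ k _ (λ i → trans (∂.neg-homo k i _) (∂v≈0 (inj₂ (j , i))))

      φ∈𝔪 : ∀ b j → 𝔪 (φ b j)
      φ∈𝔪 b zero    = IsSubgroup.neg-closed 𝔪-subgroup (x∈𝔪 zero _)
      φ∈𝔪 b (suc j) = x∈𝔪 (suc j) _

      minimal′ : ∀ k v i → 𝔪 (∂′ k v i)
      minimal′ zero    v (j , i)        = IsSubgroup.+-closed 𝔪-subgroup (minimal _ _ _) (φ∈𝔪 _ j)
      minimal′ (suc k) v (inj₁ (j , i)) = IsSubgroup.+-closed 𝔪-subgroup (minimal _ _ _) (φ∈𝔪 _ j)
      minimal′ (suc k) v (inj₂ (j , i)) = IsSubgroup.neg-closed 𝔪-subgroup (minimal _ _ _)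

      cone : Resolution 𝔪
      cone = record
        { Index = Index′ ; aug = aug′ ; ∂ = ∂′ ; aug-linear = aug′-linear ; ∂-linear = ∂′-linear
        ; aug-∂ = aug′-∂′ ; ∂-∂ = ∂′-∂′ ; exact₀ = exact₀′ ; exact₊ = exact₊′ ; minimal = minimal′ }

      -- Carries the commutation property through the cone, so that the hypothesis `div-aug` will be
      -- available for a further cycle.
      aug′-commutes : ∀ {s} → Additive s → (∀ j p → s (g j * p) ≈ g j * s p) →
                      CommutesWith s aug → CommutesWith s aug′
      aug′-commutes {s} add s-g s-aug v =
        trans (Additive.sum-homo add {n = suc m} (λ j → g j * aug (λ i → v (j , i))))
          (sum-cong-≋ {n = suc m} (λ j → trans (s-g j _) (*-congˡ (s-aug (λ i → v (j , i))))))

-- Iterating the cone over a family of cycles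

module Iteration {c ℓ : Level} (R : CommutativeRing c ℓ) where
  open CommutativeRing R hiding (zero)
  open Complexes R
  open SetoidReasoning setoid

  sum-single : ∀ {n} (u : Fin n → Carrier) j → (∀ i → i ≢ j → u i ≈ 0#) → sum u ≈ u j
  sum-single {suc n} u j others = begin
    sum u                                   ≈⟨ sum-remove {i = j} u ⟩
    u j + sum (u ∘ punchIn j)               ≈⟨ +-congˡ (sum-cong-≋ {n = n} (λ k → others _ (punchInᵢ≢i j k))) ⟩
    u j + sum {n} (λ _ → 0#)                ≈⟨ +-congˡ (sum-replicate-zero n) ⟩
    u j + 0#                                ≈⟨ +-identityʳ _ ⟩
    u j                                     ∎

  δ : ∀ {b} → Fin b → Fin b → Carrier
  δ j i with i Fin.≟ j
  ... | yes _ = 1#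
  ... | no  _ = 0#

  δ-diagonal : ∀ {b} (j : Fin b) → δ j j ≈ 1#
  δ-diagonal j with j Fin.≟ j
  ... | yes _ = refl
  ... | no ne = contradiction ≡.refl ne

  δ-off : ∀ {b} (j i : Fin b) → i ≢ j → δ j i ≈ 0#
  δ-off j i i≢j with i Fin.≟ j
  ... | yes e = contradiction e i≢j
  ... | no _  = refl

  module _ {A : Set} {b : ℕ} (A↔Fin : A ↔ Fin b) where
    open Inverse A↔Fin using (to; from; strictlyInverseˡ; strictlyInverseʳ)

    linear-matrix : ∀ {f : (A → Carrier) → Carrier} → Linear f → ∀ v →
                    f v ≈ sum (λ j → f (δ j ∘ to) * v (from j))
    linear-matrix {f} lin v = begin
      f v
        ≈⟨ Linear.cong lin expand ⟩
      f (λ a → sum (λ j → v (from j) * δ j (to a)))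
        ≈⟨ Linear.sum-homo lin {n = b} (λ j a → v (from j) * δ j (to a)) ⟩
      sum (λ j → f (λ a → v (from j) * δ j (to a)))
        ≈⟨ sum-cong-≋ {n = b} (λ j → trans (Linear.*-homo lin (v (from j)) (δ j ∘ to)) (*-comm _ _)) ⟩
      sum (λ j → f (δ j ∘ to) * v (from j)) ∎
      where
      expand : ∀ a → v a ≈ sum (λ j → v (from j) * δ j (to a))
      expand a = sym (begin
        sum (λ j → v (from j) * δ j (to a))
          ≈⟨ sum-single _ (to a) (λ i ne → trans (*-congˡ (δ-off i (to a) (ne ∘ ≡.sym))) (zeroʳ _)) ⟩
        v (from (to a)) * δ (to a) (to a)
          ≈⟨ *-cong (reflexive (≡.cong v (strictlyInverseʳ a))) (δ-diagonal (to a)) ⟩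
        v a * 1#
          ≈⟨ *-identityʳ _ ⟩
        v a ∎)

  module _ {𝔪 : Carrier → Set ℓ} (𝔪-subgroup : IsSubgroup 𝔪) where

    -- The last two fields are what edge-disjointness becomes in the ring: division by a variable of
    -- one cycle commutes with the generators belonging to the others and with `μ`.
    record Family (t : ℕ) : Set (c ⊔ ℓ) where
      field
        m        : Fin t → ℕ
        factor   : ∀ i → Factor 𝔪 (m i)
        μ        : Carrier
        μ-cancel : ∀ {p} → μ * p ≈ 0# → p ≈ 0#
      module F i = Factor (factor i)
      field
        div-μ : ∀ i j p → F.div i j (μ * p) ≈ μ * F.div i j p
        div-g : ∀ {i i′} → i ≢ i′ → ∀ j j′ p → F.div i j (F.g i′ j′ * p) ≈ F.g i′ j′ * F.div i j p

    rest : ∀ {t} → Family (suc t) → Family t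
    rest 𝓕 = record
      { m = m ∘ suc ; factor = λ i → factor (suc i) ; μ = μ ; μ-cancel = μ-cancel
      ; div-μ = λ i → div-μ (suc i) ; div-g = λ i≢i′ → div-g (i≢i′ ∘ suc-injective) }
      where open Family 𝓕

    resolve : ∀ {t} → Family t → Resolution 𝔪
    -- Mutual with `resolve`, since each cone requires this property of the previous resolution. The
    -- map `s` is arbitrary because the variable divided by belongs to a cycle outside the family
    -- over which the induction runs.
    aug-commutes : ∀ {t} (𝓕 : Family t) {s} → Additive s →
      (∀ i j p → s (Family.F.g 𝓕 i j * p) ≈ Family.F.g 𝓕 i j * s p) →
      (∀ p → s (Family.μ 𝓕 * p) ≈ Family.μ 𝓕 * s p) →
      CommutesWith s (Resolution.aug (resolve 𝓕))

    div-commutes : ∀ {t} (𝓕 : Family (suc t)) j →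
      CommutesWith (Family.F.div 𝓕 zero j) (Resolution.aug (resolve (rest 𝓕)))

    resolve {zero}  𝓕 = principal 𝔪-subgroup (Family.μ 𝓕) (Family.μ-cancel 𝓕)
    resolve {suc t} 𝓕 = Cone.cone 𝔪-subgroup (factor zero) (resolve (rest 𝓕)) (div-commutes 𝓕)
      where open Family 𝓕

    div-commutes 𝓕 j = aug-commutes (rest 𝓕) (F.div-additive zero j) (λ i → div-g (λ ()) j) (div-μ zero j)
      where open Family 𝓕

    aug-commutes {zero}  𝓕 add s-g s-μ v = s-μ _
    aug-commutes {suc t} 𝓕 add s-g s-μ =
      Cone.aug′-commutes 𝔪-subgroup (factor zero) (resolve (rest 𝓕)) (div-commutes 𝓕) add (s-g zero)
        (aug-commutes (rest 𝓕) add (λ i → s-g (suc i)) s-μ)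
      where open Family 𝓕

    Index : ∀ {t} → Family t → ℕ → Set
    Index 𝓕 = Resolution.Index (resolve 𝓕)

    Index↔Fin : ∀ {t} (𝓕 : Family t) k → Index 𝓕 k ↔ Fin (rank t (Family.m 𝓕) k)
    Index↔Fin {zero}  𝓕 zero    = ↔-sym 1↔⊤
    Index↔Fin {zero}  𝓕 (suc k) = ↔-sym 0↔⊥
    Index↔Fin {suc t} 𝓕 zero    = ↔-sym *↔× ↔-∘ (↔-id _ ×-↔ Index↔Fin (rest 𝓕) zero)
    Index↔Fin {suc t} 𝓕 (suc k) = ↔-sym +↔⊎ ↔-∘
      ((↔-sym *↔× ↔-∘ (↔-id _ ×-↔ Index↔Fin (rest 𝓕) (suc k))) ⊎-↔
       (↔-sym *↔× ↔-∘ (↔-id _ ×-↔ Index↔Fin (rest 𝓕) k)))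

    -- A basis element in degree 0 amounts to picking one edge of each cycle, the edge that the
    -- corresponding generator omits.
    choice : ∀ {t} (𝓕 : Family t) → Index 𝓕 0 → ∀ i → Fin (suc (Family.m 𝓕 i))
    choice {suc t} 𝓕 (j , a) zero    = j
    choice {suc t} 𝓕 (j , a) (suc i) = choice (rest 𝓕) a i

    fromChoice : ∀ {t} (𝓕 : Family t) → (∀ i → Fin (suc (Family.m 𝓕 i))) → Index 𝓕 0
    fromChoice {zero}  𝓕 s = tt
    fromChoice {suc t} 𝓕 s = s zero , fromChoice (rest 𝓕) (λ i → s (suc i))

    choice-fromChoice : ∀ {t} (𝓕 : Family t) s i → choice 𝓕 (fromChoice 𝓕 s) i ≡ s i
    choice-fromChoice {suc t} 𝓕 s zero    = ≡.refl
    choice-fromChoice {suc t} 𝓕 s (suc i) = choice-fromChoice (rest 𝓕) (λ i → s (suc i)) i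

    generator : ∀ {t} (𝓕 : Family t) → (∀ i → Fin (suc (Family.m 𝓕 i))) → Carrier
    generator {zero}  𝓕 s = Family.μ 𝓕
    generator {suc t} 𝓕 s = Family.F.g 𝓕 zero (s zero) * generator (rest 𝓕) (λ i → s (suc i))

    -- Any `χ` with the values of an indicator is allowed, so that its restriction to the block of
    -- `j` is again of this kind and the induction goes through.
    aug-indicator : ∀ {t} (𝓕 : Family t) a (χ : Index 𝓕 0 → Carrier) →
                    χ a ≈ 1# → (∀ a′ → a′ ≢ a → χ a′ ≈ 0#) →
                    Resolution.aug (resolve 𝓕) χ ≈ generator 𝓕 (choice 𝓕 a)
    aug-indicator {zero}  𝓕 tt χ on off = trans (*-congˡ on) (*-identityʳ _)
    aug-indicator {suc t} 𝓕 (j , a) χ on off = begin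
      sum (λ j′ → g zero j′ * aug (λ a′ → χ (j′ , a′)))
        ≈⟨ sum-single (λ j′ → g zero j′ * aug (λ a′ → χ (j′ , a′))) j (λ j′ ne → trans
             (*-congˡ (trans (Linear.cong aug-linear (λ a′ → off (j′ , a′) (ne ∘ ≡.cong proj₁))) (Linear.0-homo aug-linear)))
             (zeroʳ _)) ⟩
      g zero j * aug (λ a′ → χ (j , a′))
        ≈⟨ *-congˡ (aug-indicator (rest 𝓕) a (λ a′ → χ (j , a′)) on (λ a′ ne → off _ (ne ∘ ,-injectiveʳ))) ⟩
      g zero j * generator (rest 𝓕) (choice (rest 𝓕) a) ∎
      where
      open Family 𝓕 using (module F)
      open F using (g)
      open Resolution (resolve (rest 𝓕)) using (aug; aug-linear)

    aug-δ : ∀ {t} (𝓕 : Family t) j →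
            Resolution.aug (resolve 𝓕) (δ j ∘ Inverse.to (Index↔Fin 𝓕 0)) ≈ generator 𝓕 (choice 𝓕 (Inverse.from (Index↔Fin 𝓕 0) j))
    aug-δ 𝓕 j = aug-indicator 𝓕 (from j) (δ j ∘ to)
      (trans (reflexive (≡.cong (δ j) (strictlyInverseˡ j))) (δ-diagonal j))
      (λ a′ ne → δ-off j (to a′) (λ e → ne (≡.trans (≡.sym (strictlyInverseʳ a′)) (≡.cong from e))))
      where open Inverse (Index↔Fin 𝓕 0)

-- From index types to matrices over the polynomial ring

module Matrices {c ℓ : Level} (K : Field c ℓ) (n : ℕ) where
  open PolyRing K n hiding (ε)
  open Polynomials K n
  open Complexes polyRing hiding (module Cone)
  open Iteration polyRing hiding (Index)

  ≃-reflexive : ∀ {p q} → p ≡ q → p ≃ q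
  ≃-reflexive ≡.refl = ≃-refl

  ΣP≃sum : ∀ b {f g : Fin b → Poly} → (∀ j → f j ≃ g j) → ΣP b f ≃ sum g
  ΣP≃sum zero    e = ≃-refl
  ΣP≃sum (suc b) {f} e =
    ≃-trans (≃-reflexive (≡.sym (⊞≡+P (f zero) _))) (⊞-cong (e zero) (ΣP≃sum b (λ j → e (suc j))))

  *P≃⊠ : ∀ p q → p *P q ≃ p ⊠ q
  *P≃⊠ p q rewrite ⊠≡*P p q = ≃-refl

  In𝔪-subgroup : IsSubgroup In𝔪
  In𝔪-subgroup = record { 0-closed = Field.refl K ; +-closed = λ {p} {q} → In𝔪-⊞ {p} {q} ; neg-closed = λ {p} → In𝔪-⊟ {p} }

  module _ {t : ℕ} (𝓕 : Family In𝔪-subgroup t) where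
    private
      ranks : ℕ → ℕ
      ranks = rank t (Family.m 𝓕)
      module Inv k = Inverse (Index↔Fin In𝔪-subgroup 𝓕 k)
    open Resolution (resolve In𝔪-subgroup 𝓕) renaming (exact₀ to exact-aug; minimal to ∂-minimal)

    basis : ∀ k → Fin (ranks k) → Index k → Poly
    basis k j a = δ j (Inv.to k a)

    augVector : FreeElt (ranks 0)
    augVector j = aug (basis 0 j)

    -- The index k of the target is only propositionally equal to toℕ (inject₁ i).
    matrix : ∀ m k → m ≡ k → Matrix (ranks m) (ranks (suc k))
    matrix m .m ≡.refl i j = ∂ m (basis (suc m) j) (Inv.from m i)

    ε-aug : ∀ v → PolyRing.ε K n augVector v ≃ aug (v ∘ Inv.to 0)
    ε-aug v = ≃-trans (ΣP≃sum (ranks 0) (λ j → ≃-trans (*P≃⊠ (v j) _) (⊠-comm (v j) _))) (≃-sym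
      (≃-trans (linear-matrix (Index↔Fin In𝔪-subgroup 𝓕 0) aug-linear (v ∘ Inv.to 0))
        (sum-cong-≋ {n = ranks 0} (λ j → ⊠-congˡ _ (≃-reflexive (≡.cong v (Inv.strictlyInverseˡ 0 j)))))))

    apply-∂ : ∀ k v i → apply (matrix k k ≡.refl) v i ≃ ∂ k (v ∘ Inv.to (suc k)) (Inv.from k i)
    apply-∂ k v i = ≃-trans (ΣP≃sum (ranks (suc k)) (λ j → *P≃⊠ _ (v j))) (≃-sym
      (≃-trans (linear-matrix (Index↔Fin In𝔪-subgroup 𝓕 (suc k)) (∂-linear k (Inv.from k i)) (v ∘ Inv.to (suc k)))
        (sum-cong-≋ {n = ranks (suc k)} (λ j → ⊠-congˡ _ (≃-reflexive (≡.cong v (Inv.strictlyInverseˡ (suc k) j)))))))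

    apply-∂∘to : ∀ k v a → apply (matrix k k ≡.refl) v (Inv.to k a) ≃ ∂ k (v ∘ Inv.to (suc k)) a
    apply-∂∘to k v a = ≡.subst (λ a′ → apply (matrix k k ≡.refl) v (Inv.to k a) ≃ ∂ k (v ∘ Inv.to (suc k)) a′)
      (Inv.strictlyInverseʳ k a) (apply-∂ k v (Inv.to k a))

    matrix-aug : ∀ k (e : 0 ≡ k) w → PolyRing.ε K n augVector (apply (matrix 0 k e) w) ≈P 0P
    matrix-aug .0 ≡.refl w = coeff-≈ (≃-trans (ε-aug (apply (matrix 0 0 ≡.refl) w))
      (≃-trans (Linear.cong aug-linear (apply-∂∘to 0 w)) (aug-∂ _)))

    matrix-matrix : ∀ a b c (e : a ≡ b) (f : suc b ≡ suc c) w →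
                    apply (matrix a b e) (apply (matrix (suc b) (suc c) f) w) ≈V 0V
    matrix-matrix a .a .a ≡.refl ≡.refl w i = coeff-≈ (≃-trans (apply-∂ a _ i)
      (≃-trans (Linear.cong (∂-linear a _) (apply-∂∘to (suc a) w)) (∂-∂ a _ _)))

    matrix-exact₀ : ∀ k (e : 0 ≡ k) v → PolyRing.ε K n augVector v ≈P 0P → ∃[ w ] (apply (matrix 0 k e) w ≈V v)
    matrix-exact₀ .0 ≡.refl v εv≈0 with exact-aug (v ∘ Inv.to 0) (≃-trans (≃-sym (ε-aug v)) (by-coeff εv≈0))
    ... | w , ∂w≈v = w ∘ Inv.from 1 , λ i → coeff-≈ (≃-trans (apply-∂ 0 _ i)
      (≃-trans (Linear.cong (∂-linear 0 _) (λ a → ≃-reflexive (≡.cong w (Inv.strictlyInverseʳ 1 a))))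
        (≃-trans (∂w≈v _) (≃-reflexive (≡.cong v (Inv.strictlyInverseˡ 0 i))))))

    matrix-exact₊ : ∀ a b c (e : a ≡ b) (f : suc b ≡ suc c) v → apply (matrix a b e) v ≈V 0V →
                    ∃[ w ] (apply (matrix (suc b) (suc c) f) w ≈V v)
    matrix-exact₊ a .a .a ≡.refl ≡.refl v Av≈0 with exact₊ a (v ∘ Inv.to (suc a))
      (λ i → ≃-trans (≃-sym (apply-∂∘to a v i)) (by-coeff (Av≈0 _)))
    ... | w , ∂w≈v = w ∘ Inv.from (suc (suc a)) , λ i → coeff-≈ (≃-trans (apply-∂ (suc a) _ i)
      (≃-trans (Linear.cong (∂-linear (suc a) _) (λ x → ≃-reflexive (≡.cong w (Inv.strictlyInverseʳ (suc (suc a)) x))))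
        (≃-trans (∂w≈v _) (≃-reflexive (≡.cong v (Inv.strictlyInverseˡ (suc a) i))))))

    apply-rank-zero : ∀ a b (e : a ≡ b) → ranks (suc b) ≡ 0 → ∀ w → apply (matrix a b e) w ≈V 0V
    apply-rank-zero a .a ≡.refl r≡0 w i = coeff-≈ (≃-trans (apply-∂ a w i)
      (≃-trans (Linear.cong (∂-linear a _) (λ x → ⊥-elim (no-index (Inv.to (suc a) x)))) (Linear.0-homo (∂-linear a _))))
      where
      no-index : ¬ Fin (ranks (suc a))
      no-index rewrite r≡0 = λ ()

    matrix-minimal : ∀ a b (e : a ≡ b) w r → In𝔪 (apply (matrix a b e) w r)
    matrix-minimal a .a ≡.refl w r = In𝔪-cong (≃-sym (apply-∂ a w r)) (∂-minimal a _ _)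

    -- The length is a variable `t′` rather than the fixed `t`, so that the proofs about it can
    -- split on the index `i`.
    differential : ∀ {t′} (i : Fin t′) → Matrix (ranks (toℕ (inject₁ i))) (ranks (suc (toℕ i)))
    differential i = matrix (toℕ (inject₁ i)) (toℕ i) (toℕ-inject₁ i)

    -- Injectivity at the end is exactness of the unbounded complex one degree further: a kernel
    -- element has a preimage in a module of rank zero.
    exact-last : ∀ t′ → ranks (suc t′) ≡ 0 → ∀ v →
                 KerOut {b = λ i → ranks (toℕ i)} augVector differential (fromℕ t′) v → v ≈V 0V
    exact-last zero r≡0 v εv≈0 i m with matrix-exact₀ 0 ≡.refl v εv≈0
    ... | w , Aw≈v = Field.trans K (Field.sym K (Aw≈v i m)) (apply-rank-zero 0 0 ≡.refl r≡0 w i m)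
    exact-last (suc t′) r≡0 v Av≈0 i m with matrix-exact₊ _ (toℕ (fromℕ t′)) _ (toℕ-inject₁ (fromℕ t′)) ≡.refl v Av≈0
    ... | w , Aw≈v = Field.trans K (Field.sym K (Aw≈v i m))
      (apply-rank-zero _ _ ≡.refl (≡.trans (≡.cong (λ k → ranks (suc (suc k))) (toℕ-fromℕ t′)) r≡0) w i m)

    minimalFreeResolution : ∀ {p} {I : Poly → Set p} →
      (∀ s q → q ≃ generator In𝔪-subgroup 𝓕 s → I q) →
      (∀ q → I q → ∃[ v ] (q ≃ aug v)) →
      MinimalFreeResolution I t (λ i → ranks (toℕ i))
    minimalFreeResolution {I = I} generator∈I onto = record
      { aug       = augVector
      ; d         = differential
      ; aug∈I     = λ j → generator∈I _ _ (aug-δ In𝔪-subgroup 𝓕 j)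
      ; ε-onto    = λ q q∈I → let v , q≃ = onto q q∈I in v ∘ Inv.from 0 ,
          coeff-≈ (≃-trans q≃ (≃-sym (≃-trans (ε-aug (v ∘ Inv.from 0))
            (Linear.cong aug-linear (λ a → ≃-reflexive (≡.cong v (Inv.strictlyInverseʳ 0 a)))))))
      ; isComplex = complex
      ; exact     = exactness
      ; exactLast = exact-last t (rank-high t (Family.m 𝓕) (suc t) ℕ.≤-refl)
      ; minimal   = λ i → matrix-minimal _ _ (toℕ-inject₁ i)
      }
      where
      complex : ∀ {t′} (i : Fin t′) w → KerOut {b = λ i → ranks (toℕ i)} augVector differential (inject₁ i) (apply (differential i) w)
      complex zero    w = matrix-aug 0 ≡.refl w
      complex (suc i) w = matrix-matrix _ _ _ (toℕ-inject₁ (inject₁ i)) (toℕ-inject₁ (suc i)) w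
      exactness : ∀ {t′} (i : Fin t′) v → KerOut {b = λ i → ranks (toℕ i)} augVector differential (inject₁ i) v →
                  ∃[ w ] (apply (differential i) w ≈V v)
      exactness zero    v = matrix-exact₀ 0 ≡.refl v
      exactness (suc i) v = matrix-exact₊ _ _ _ (toℕ-inject₁ (inject₁ i)) (toℕ-inject₁ (suc i)) v

-- Subsets given by decidable predicates

⟦_⟧ : ∀ {n} {P : Pred (Fin n) 0ℓ} → Decidable P → Subset n
⟦ P? ⟧ = Vec.tabulate (λ e → does (P? e))

∈⟦⟧⁺ : ∀ {n} {P : Pred (Fin n) 0ℓ} (P? : Decidable P) {e} → P e → e ∈ ⟦ P? ⟧
∈⟦⟧⁺ P? {e} Pe = lookup⇒[]= e _ (≡.trans (lookup∘tabulate _ e) (dec-true (P? e) Pe))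

∈⟦⟧⁻ : ∀ {n} {P : Pred (Fin n) 0ℓ} (P? : Decidable P) {e} → e ∈ ⟦ P? ⟧ → P e
∈⟦⟧⁻ P? {e} e∈ with P? e | ≡.trans (≡.sym (lookup∘tabulate (λ e → does (P? e)) e)) ([]=⇒lookup e∈)
... | yes Pe | _  = Pe
... | no _   | ()

-- Cycles, nonseparable edge sets and blocks

module Cacti (G : Graph) where
  open Graph G
  open GraphTheory G
  open ≡ using (refl; sym; trans; cong; subst; subst₂; module ≡-Reasoning)

  Joins-sym : ∀ {e u v} → Joins e u v → Joins e v u
  Joins-sym (inj₁ eq) = inj₂ eq
  Joins-sym (inj₂ eq) = inj₁ eq

  Joins⇒Incidentˡ : ∀ {e u v} → Joins e u v → Incident e u
  Joins⇒Incidentˡ (inj₁ eq) = inj₁ (cong proj₁ eq)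
  Joins⇒Incidentˡ (inj₂ eq) = inj₂ (cong proj₂ eq)

  Joins⇒Incidentʳ : ∀ {e u v} → Joins e u v → Incident e v
  Joins⇒Incidentʳ = Joins⇒Incidentˡ ∘ Joins-sym

  Incident-Joins : ∀ {e u v w} → Joins e u v → Incident e w → u ≡ w ⊎ v ≡ w
  Incident-Joins (inj₁ eq) (inj₁ i) = inj₁ (trans (sym (cong proj₁ eq)) i)
  Incident-Joins (inj₁ eq) (inj₂ i) = inj₂ (trans (sym (cong proj₂ eq)) i)
  Incident-Joins (inj₂ eq) (inj₁ i) = inj₂ (trans (sym (cong proj₁ eq)) i)
  Incident-Joins (inj₂ eq) (inj₂ i) = inj₁ (trans (sym (cong proj₂ eq)) i)

  incident? : ∀ e v → Dec (Incident e v)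
  incident? e v = (proj₁ (ends e) Fin.≟ v) ⊎-dec (proj₂ (ends e) Fin.≟ v)

  inV? : ∀ B v → Dec (InV B v)
  inV? B v = any? (λ e → (e ∈? B) ×-dec incident? e v)

  module _ {P : Edge → Set} where
    _++ʷ_ : ∀ {u v w} → Walk P u v → Walk P v w → Walk P u w
    []      ++ʷ q = q
    (s ∷ p) ++ʷ q = s ∷ (p ++ʷ q)

    reverse : ∀ {u v} → Walk P u v → Walk P v u
    reverse []                 = []
    reverse ((e , Pe , j) ∷ p) = reverse p ++ʷ ((e , Pe , Joins-sym j) ∷ [])

  map-walk : ∀ {P Q : Edge → Set} → (∀ {e} → P e → Q e) → ∀ {u v} → Walk P u v → Walk Q u v
  map-walk f []                 = []
  map-walk f ((e , Pe , j) ∷ p) = (e , f Pe , j) ∷ map-walk f p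

  module Cyclic (C : Cycle) where
    open Cycle C

    suc-% : ∀ i → suc (i % suc k) % suc k ≡ suc i % suc k
    suc-% i = begin
      suc (i % suc k) % suc k                              ≡⟨ %-distribˡ-+ 1 (i % suc k) (suc k) ⟩
      (1 % suc k ℕ.+ i % suc k % suc k) % suc k            ≡⟨ cong (λ z → (1 % suc k ℕ.+ z) % suc k) (m%n%n≡m%n i (suc k)) ⟩
      (1 % suc k ℕ.+ i % suc k) % suc k                    ≡⟨ %-distribˡ-+ 1 i (suc k) ⟨
      suc i % suc k                                        ∎
      where open ≡-Reasoning

    opaque
      -- Positions on the cycle are natural numbers read modulo its length, so that going round is
      -- plain `suc` and `cycSuc` appears only in `cycSuc-index`.
      index : ℕ → Fin (suc k)
      index i = fromℕ< (m%n<n i (suc k))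

    opaque
      unfolding index

      index-cong : ∀ {i j} → i % suc k ≡ j % suc k → index i ≡ index j
      index-cong eq = fromℕ<-cong _ _ eq _ _

      index-mod : ∀ {i j} → index i ≡ index j → i % suc k ≡ j % suc k
      index-mod eq = trans (sym (toℕ-fromℕ< _)) (trans (cong toℕ eq) (toℕ-fromℕ< _))

      cycSuc-index : ∀ i → cycSuc (index i) ≡ index (suc i)
      cycSuc-index i = fromℕ<-cong _ _ (trans (cong (λ z → suc z % suc k) (toℕ-fromℕ< _)) (suc-% i)) _ _

      index-toℕ : ∀ a → index (toℕ a) ≡ a
      index-toℕ a = trans (fromℕ<-cong _ _ (m<n⇒m%n≡m (toℕ<n a)) _ (toℕ<n a)) (fromℕ<-toℕ a (toℕ<n a))

    index-period : ∀ i → index (suc k ℕ.+ i) ≡ index i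
    index-period i = index-cong (trans (cong (_% suc k) (ℕ.+-comm (suc k) i)) ([m+n]%n≡m%n i (suc k)))

    index-suc-cong : ∀ {i j} → index i ≡ index j → index (suc i) ≡ index (suc j)
    index-suc-cong {i} {j} eq = trans (sym (cycSuc-index i)) (trans (cong cycSuc eq) (cycSuc-index j))

    index-+-cong : ∀ m {i j} → index i ≡ index j → index (m ℕ.+ i) ≡ index (m ℕ.+ j)
    index-+-cong zero    eq = eq
    index-+-cong (suc m) eq = index-suc-cong (index-+-cong m eq)

    -- After one step, `k` further steps complete a full turn and so undo it.
    index-suc-injective : ∀ {i j} → index (suc i) ≡ index (suc j) → index i ≡ index j
    index-suc-injective {i} {j} eq = begin
      index i                ≡⟨ index-period i ⟨
      index (suc k ℕ.+ i)    ≡⟨ cong index (ℕ.+-suc k i) ⟨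
      index (k ℕ.+ suc i)    ≡⟨ index-+-cong k eq ⟩
      index (k ℕ.+ suc j)    ≡⟨ cong index (ℕ.+-suc k j) ⟩
      index (suc k ℕ.+ j)    ≡⟨ index-period j ⟩
      index j                ∎
      where open ≡-Reasoning

    offset : ∀ p a → ∃[ i ] (i ℕ.< suc k × index (i ℕ.+ p) ≡ a)
    offset zero    a = toℕ a , toℕ<n a , trans (cong index (ℕ.+-identityʳ (toℕ a))) (index-toℕ a)
    offset (suc p) a with offset p a
    ... | suc i , i<k , eq = i , ℕ.m<n⇒m<1+n (ℕ.s≤s⁻¹ i<k) , trans (cong index (ℕ.+-suc i p)) eq
    -- `a` is the position `p` itself, which seen from `suc p` is reached only after `k` steps, at
    -- the end of the turn.
    ... | zero  , _   , eq = k , ℕ.≤-refl , trans (cong index (ℕ.+-suc k p)) (trans (index-period p) eq)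

    offset-zero : ∀ p i → i ℕ.< suc k → index (i ℕ.+ p) ≡ index p → i ≡ 0
    offset-zero zero i i<k eq = begin
      i                      ≡⟨ m<n⇒m%n≡m i<k ⟨
      i % suc k              ≡⟨ cong (_% suc k) (ℕ.+-identityʳ i) ⟨
      (i ℕ.+ 0) % suc k      ≡⟨ index-mod eq ⟩
      0 % suc k              ≡⟨ m<n⇒m%n≡m {n = suc k} (ℕ.s≤s ℕ.z≤n) ⟩
      0                      ∎
      where open ≡-Reasoning
    offset-zero (suc p) i i<k eq =
      offset-zero p i i<k (index-suc-injective (trans (sym (cong index (ℕ.+-suc i p))) eq))

    vertex : ℕ → Vertex
    vertex = vs ∘ index

    edge : ℕ → Edge
    edge = es ∘ index

    edge-joins : ∀ i → Joins (edge i) (vertex i) (vertex (suc i))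
    edge-joins i = subst (λ a → Joins (edge i) (vertex i) (vs a)) (cycSuc-index i) (joins (index i))

    onCycle? : Decidable OnCycle
    onCycle? e = any? (λ i → es i Fin.≟ e)

    edges : Subset ne
    edges = ⟦ onCycle? ⟧

    edge-OnCycle : ∀ i → OnCycle (edge i)
    edge-OnCycle i = index i , refl

    OnCycle-edge : ∀ {e} → OnCycle e → ∃[ i ] (edge i ≡ e)
    OnCycle-edge (a , eq) = toℕ a , trans (cong es (index-toℕ a)) eq

    1<length : 1 ℕ.< suc k
    1<length = ℕ.≤-trans (ℕ.s≤s (ℕ.s≤s ℕ.z≤n)) len≥3

    k≢0 : k ≢ 0
    k≢0 refl = case len≥3 of λ { (ℕ.s≤s ()) }

    InV-edges : ∀ {v} → InV edges v → ∃[ i ] (vertex i ≡ v)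
    InV-edges (e , e∈ , inc) with OnCycle-edge (∈⟦⟧⁻ onCycle? e∈)
    ... | i , refl with Incident-Joins (edge-joins i) inc
    ...   | inj₁ eq = i , eq
    ...   | inj₂ eq = suc i , eq

    nonseparable : Nonseparable edges
    nonseparable = (edge 0 , ∈⟦⟧⁺ onCycle? (edge-OnCycle 0)) , connected , 2-connected
      where
      from-0 : ∀ i → Walk (λ e → e ∈ edges) (vertex 0) (vertex i)
      from-0 zero    = []
      from-0 (suc i) = from-0 i ++ʷ ((edge i , ∈⟦⟧⁺ onCycle? (edge-OnCycle i) , edge-joins i) ∷ [])

      connected : ∀ u v → InV edges u → InV edges v → Walk (λ e → e ∈ edges) u v
      connected u v u∈ v∈ with InV-edges u∈ | InV-edges v∈
      ... | i , refl | j , refl = reverse (from-0 i) ++ʷ from-0 j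

      -- Deleting the vertex at `p` leaves the path through the positions `p + 1` to `p + k`. Every
      -- other vertex is joined along it to `vertex (suc p)`, which serves as a hub.
      module _ (p : ℕ) where
        Avoiding : Edge → Set
        Avoiding e = e ∈ edges × ¬ Incident e (vertex p)

        from-next : ∀ i → suc i ℕ.< suc k → Walk Avoiding (vertex (suc p)) (vertex (suc i ℕ.+ p))
        from-next zero    _    = []
        from-next (suc i) i<k = from-next i (ℕ.<-trans (ℕ.n<1+n _) i<k) ++ʷ
          ((edge (suc i ℕ.+ p) , (∈⟦⟧⁺ onCycle? (edge-OnCycle _) , avoids) , edge-joins _) ∷ [])
          where
          avoids : ¬ Incident (edge (suc i ℕ.+ p)) (vertex p)
          avoids inc with Incident-Joins (edge-joins (suc i ℕ.+ p)) inc
          ... | inj₁ eq = ℕ.1+n≢0 (offset-zero p (suc i) (ℕ.<-trans (ℕ.n<1+n _) i<k) (vs-inj eq))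
          ... | inj₂ eq = ℕ.1+n≢0 (offset-zero p (suc (suc i)) i<k (vs-inj eq))

        to-next : ∀ j → vertex j ≢ vertex p → Walk Avoiding (vertex (suc p)) (vertex j)
        to-next j ne with offset p (index j)
        ... | zero  , _   , eq = contradiction (cong vs (sym eq)) ne
        ... | suc i , i<k , eq = subst (Walk Avoiding _) (cong vs eq) (from-next i i<k)

      2-connected : ∀ w u v → InV edges w → InV edges u → InV edges v → u ≢ w → v ≢ w →
                    Walk (λ e → e ∈ edges × ¬ Incident e w) u v
      2-connected w u v w∈ u∈ v∈ u≢w v≢w with InV-edges w∈ | InV-edges u∈ | InV-edges v∈
      ... | p , refl | i , refl | j , refl = reverse (to-next p i u≢w) ++ʷ to-next p j v≢w

    another-edge : ∀ {e v} → OnCycle e → Incident e v → ∃[ f ] (OnCycle f × f ≢ e × Incident f v)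
    another-edge on inc with OnCycle-edge on
    ... | r , refl with Incident-Joins (edge-joins r) inc
    -- Modulo the length, `k + r` is the position just before `r`.
    ...   | inj₁ refl = edge (k ℕ.+ r) , edge-OnCycle _
      , (λ eq → k≢0 (offset-zero r k (ℕ.n<1+n k) (es-inj eq)))
      , subst (Incident (edge (k ℕ.+ r))) (cong vs (index-period r)) (Joins⇒Incidentʳ (edge-joins (k ℕ.+ r)))
    ...   | inj₂ refl = edge (suc r) , edge-OnCycle _
      , (λ eq → ℕ.1+n≢0 (offset-zero r 1 1<length (es-inj eq)))
      , Joins⇒Incidentˡ (edge-joins (suc r))

    edges-at : ∀ j {e} → OnCycle e → Incident e (vertex (suc j)) → e ≡ edge j ⊎ e ≡ edge (suc j)
    edges-at j on inc with OnCycle-edge on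
    ... | s , refl with Incident-Joins (edge-joins s) inc
    ...   | inj₁ eq = inj₂ (cong es (vs-inj eq))
    ...   | inj₂ eq = inj₁ (cong es (index-suc-injective (vs-inj eq)))

  -- Walk along E from a common edge: at each vertex C continues along an edge
  -- of E other than the one it arrived by, and E has only one such edge.
  sub-cycle : ∀ C E → (∀ {e} → Cycle.OnCycle C e → Cycle.OnCycle E e) →
              ∀ {e} → Cycle.OnCycle E e → Cycle.OnCycle C e
  sub-cycle C E C⊆E (b , refl) with C⊆E (zero , refl)
  ... | a , ea≡ with E.offset (toℕ a) b
    where module E = Cyclic E
  ...   | i , _ , eq = subst (Cycle.OnCycle C ∘ Cycle.es E) eq (covered i)
    where
    module E = Cyclic E
    covered : ∀ i → Cycle.OnCycle C (E.edge (i ℕ.+ toℕ a))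
    covered zero    = zero , sym (trans (cong (Cycle.es E) (E.index-toℕ a)) ea≡)
    covered (suc i) with Cyclic.another-edge C (covered i) (Joins⇒Incidentʳ (E.edge-joins (i ℕ.+ toℕ a)))
    ... | f , f∈C , f≢ , inc with E.edges-at (i ℕ.+ toℕ a) (C⊆E f∈C) inc
    ...   | inj₁ f≡   = contradiction f≡ f≢
    ...   | inj₂ refl = f∈C

  endpoint-avoiding : ∀ e w → ∃[ u ] (Incident e u × u ≢ w)
  endpoint-avoiding e w with proj₁ (ends e) Fin.≟ w
  ... | no ne    = proj₁ (ends e) , inj₁ refl , ne
  ... | yes refl = proj₂ (ends e) , inj₂ refl , noLoop e ∘ sym

  -- `Nonseparable` speaks only of removing vertices of `B`. For any other `w` connectedness
  -- suffices, as no edge of `B` meets `w`.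
  avoiding-walk : ∀ {B} → Nonseparable B → ∀ w u v → InV B u → InV B v → u ≢ w → v ≢ w →
                  Walk (λ e → e ∈ B × ¬ Incident e w) u v
  avoiding-walk {B} (_ , connected , 2-connected) w u v u∈ v∈ u≢w v≢w with inV? B w
  ... | yes w∈ = 2-connected w u v w∈ u∈ v∈ u≢w v≢w
  ... | no  w∉ = map-walk (λ e∈ → e∈ , λ inc → w∉ (_ , e∈ , inc)) (connected u v u∈ v∈)

  -- A common edge has two distinct endpoints, so one of them survives the removal of `w`. Walks
  -- inside `A` and inside `B` meet there.
  ∪-nonseparable : ∀ {A B} e → e ∈ A → e ∈ B → Nonseparable A → Nonseparable B → Nonseparable (A ∪ B)
  ∪-nonseparable {A} {B} e e∈A e∈B nonsepA nonsepB =
    (e , A⊆ e∈A) , connected , λ w u v _ → 2-connected w u v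
    where
    A⊆ : A ⊆ A ∪ B
    A⊆ = p⊆p∪q B
    B⊆ : B ⊆ A ∪ B
    B⊆ = q⊆p∪q A B
    InV-∪ : ∀ {v} → InV (A ∪ B) v → InV A v ⊎ InV B v
    InV-∪ (f , f∈ , inc) with x∈p∪q⁻ A B f∈
    ... | inj₁ f∈A = inj₁ (f , f∈A , inc)
    ... | inj₂ f∈B = inj₂ (f , f∈B , inc)
    hub = proj₁ (ends e)
    to-hub : ∀ u → InV (A ∪ B) u → Walk (λ e → e ∈ A ∪ B) u hub
    to-hub u u∈ with InV-∪ u∈
    ... | inj₁ u∈A = map-walk A⊆ (proj₁ (proj₂ nonsepA) u hub u∈A (e , e∈A , inj₁ refl))
    ... | inj₂ u∈B = map-walk B⊆ (proj₁ (proj₂ nonsepB) u hub u∈B (e , e∈B , inj₁ refl))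
    connected : ∀ u v → InV (A ∪ B) u → InV (A ∪ B) v → Walk (λ e → e ∈ A ∪ B) u v
    connected u v u∈ v∈ = to-hub u u∈ ++ʷ reverse (to-hub v v∈)
    2-connected : ∀ w u v → InV (A ∪ B) u → InV (A ∪ B) v → u ≢ w → v ≢ w →
                  Walk (λ e → e ∈ A ∪ B × ¬ Incident e w) u v
    2-connected w u v u∈ v∈ u≢w v≢w = to-end u u∈ u≢w ++ʷ reverse (to-end v v∈ v≢w)
      where
      end = proj₁ (endpoint-avoiding e w)
      end-incident = proj₁ (proj₂ (endpoint-avoiding e w))
      end≢w = proj₂ (proj₂ (endpoint-avoiding e w))
      to-end : ∀ u → InV (A ∪ B) u → u ≢ w → Walk (λ e → e ∈ A ∪ B × ¬ Incident e w) u end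
      to-end u u∈ u≢w with InV-∪ u∈
      ... | inj₁ u∈A = map-walk (λ (f∈ , ¬inc) → A⊆ f∈ , ¬inc)
        (avoiding-walk nonsepA w u end u∈A (e , e∈A , end-incident) u≢w end≢w)
      ... | inj₂ u∈B = map-walk (λ (f∈ , ¬inc) → B⊆ f∈ , ¬inc)
        (avoiding-walk nonsepB w u end u∈B (e , e∈B , end-incident) u≢w end≢w)

  -- Only doubly negated: nonseparability is not shown to be decidable.
  within-block : ∀ {B} → Nonseparable B → ¬ ¬ (∃[ D ] (B ⊆ D × IsBlock D))
  within-block {B} = go B (⊃-wellFounded B)
    where
    go : ∀ B → Acc _⊃_ B → Nonseparable B → ¬ ¬ (∃[ D ] (B ⊆ D × IsBlock D))
    go B (acc rec) nonsep no-block = no-block (B , id , nonsep , maximal)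
      where
      maximal : ∀ B′ → B ⊆ B′ → Nonseparable B′ → B′ ≡ B
      maximal B′ B⊆B′ nonsep′ with any? (λ e → (e ∈? B′) ×-dec ¬? (e ∈? B))
      ... | yes (e , e∈B′ , e∉B) = ⊥-elim (go B′ (rec (B⊆B′ , e , e∈B′ , e∉B)) nonsep′
        (λ (D , B′⊆D , block) → no-block (D , (λ {x} x∈B → B′⊆D (B⊆B′ x∈B)) , block)))
      ... | no none = ⊆-antisym (λ {e} e∈B′ → decidable-stable (e ∈? B) (λ e∉B → none (e , e∈B′ , e∉B))) B⊆B′

  ∣∣≡1-unique : ∀ {B : Subset ne} → ∣ B ∣ ≡ 1 → ∀ {e f} → e ∈ B → f ∈ B → e ≡ f
  ∣∣≡1-unique {B} ∣B∣≡1 {e} {f} e∈ f∈ with e Fin.≟ f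
  ... | yes e≡f = e≡f
  ... | no  e≢f = contradiction (subst₂ ℕ._<_ (∣⁅x⁆∣≡1 e) ∣B∣≡1 (p⊂q⇒∣p∣<∣q∣
    ((λ x∈ → subst (_∈ B) (sym (x∈⁅y⁆⇒x≡y e x∈)) e∈) , f , f∈ , λ f∈e → e≢f (sym (x∈⁅y⁆⇒x≡y e f∈e)))))
    (ℕ.<-irrefl refl)

  module _ (cactus : IsCactus) where
    -- The union of the two cycles is nonseparable and lies in a block. This block has more than one
    -- edge, so it is a cycle `E`, and a cycle whose edges lie on `E` exhausts `E`.
    sharing-cycles : ∀ C D {e} → Cycle.OnCycle C e → Cycle.OnCycle D e → ¬ ¬ SameEdges C D
    sharing-cycles C D {e} e∈C e∈D ¬same =
      within-block (∪-nonseparable e (∈⟦⟧⁺ C.onCycle? e∈C) (∈⟦⟧⁺ D.onCycle? e∈D) C.nonseparable D.nonseparable)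
        (λ (B , CD⊆B , block) → in-block B (λ e∈ → CD⊆B (p⊆p∪q D.edges e∈)) (λ e∈ → CD⊆B (q⊆p∪q C.edges D.edges e∈)) (proj₂ cactus B block))
      where
      module C = Cyclic C
      module D = Cyclic D
      in-block : ∀ B → C.edges ⊆ B → D.edges ⊆ B →
                 ∣ B ∣ ≡ 1 ⊎ (Σ Cycle λ E → ∀ e → (e ∈ B → Cycle.OnCycle E e) × (Cycle.OnCycle E e → e ∈ B)) → ⊥
      -- A block with a single edge would identify the edges of `C` at positions 0 and 1.
      in-block B C⊆B D⊆B (inj₁ ∣B∣≡1) = ℕ.1+n≢0 (C.offset-zero 0 1 C.1<length
        (Cycle.es-inj C (∣∣≡1-unique ∣B∣≡1 (C⊆B (∈⟦⟧⁺ C.onCycle? (C.edge-OnCycle 1))) (C⊆B (∈⟦⟧⁺ C.onCycle? (C.edge-OnCycle 0))))))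
      in-block B C⊆B D⊆B (inj₂ (E , B≡E)) = ¬same λ e →
        (λ on → sub-cycle D E D⊆E (C⊆E on)) , (λ on → sub-cycle C E C⊆E (D⊆E on))
        where
        C⊆E : ∀ {e} → Cycle.OnCycle C e → Cycle.OnCycle E e
        C⊆E on = proj₁ (B≡E _) (C⊆B (∈⟦⟧⁺ C.onCycle? on))
        D⊆E : ∀ {e} → Cycle.OnCycle D e → Cycle.OnCycle E e
        D⊆E on = proj₁ (B≡E _) (D⊆B (∈⟦⟧⁺ D.onCycle? on))

    -- Bases of the cycle matroid as complements of transversals

    module Bases {t : ℕ} (C : Fin t → Cycle)
                 (distinct : ∀ i j → SameEdges (C i) (C j) → i ≡ j)
                 (complete : ∀ D → ∃[ i ] SameEdges D (C i)) where

      -- Equality of indices is decidable, so the double negation that comes with the existence of a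
      -- block is removed here.
      edge-disjoint : ∀ {i j e} → Cycle.OnCycle (C i) e → Cycle.OnCycle (C j) e → i ≡ j
      edge-disjoint {i} {j} on on′ = decidable-stable (i Fin.≟ j)
        (λ i≢j → sharing-cycles (C i) (C j) on on′ (λ same → i≢j (distinct i j same)))

      Choice : Set
      Choice = ∀ i → Fin (Cycle.length (C i))

      chosen : Choice → Fin t → Edge
      chosen s i = Cycle.es (C i) (s i)

      unchosen? : ∀ s → Decidable (λ e → ∀ i → chosen s i ≢ e)
      unchosen? s e = all? (λ i → ¬? (chosen s i Fin.≟ e))

      unchosen : Choice → Subset ne
      unchosen s = ⟦ unchosen? s ⟧

      unchosen-acyclic : ∀ s → Acyclic (unchosen s)
      unchosen-acyclic s (D , D⊆) with complete D
      ... | i , same with proj₂ (same (chosen s i)) (s i , refl)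
      ...   | a , eq = ∈⟦⟧⁻ (unchosen? s) (D⊆ a) i (sym eq)

      -- An edge outside is the chosen edge of some cycle. Adding it completes that cycle, whose
      -- other edges are unchosen: by edge-disjointness no other cycle can choose them.
      unchosen-basis : ∀ s → IsBasis (unchosen s)
      unchosen-basis s = unchosen-acyclic s , maximal
        where
        maximal : ∀ e → e ∉ unchosen s → ¬ Acyclic (unchosen s ∪ ⁅ e ⁆)
        maximal e e∉ acyclic with any? (λ i → chosen s i Fin.≟ e)
        ... | no none = e∉ (∈⟦⟧⁺ (unchosen? s) (λ i eq → none (i , eq)))
        ... | yes (i , refl) = acyclic (C i , on-cycle)
          where
          on-cycle : ∀ a → Cycle.es (C i) a ∈ unchosen s ∪ ⁅ e ⁆
          on-cycle a with Cycle.es (C i) a Fin.≟ e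
          ... | yes eq = q⊆p∪q (unchosen s) ⁅ e ⁆ (subst (_∈ ⁅ e ⁆) (sym eq) (x∈⁅x⁆ e))
          ... | no ne  = p⊆p∪q ⁅ e ⁆ (∈⟦⟧⁺ (unchosen? s) other)
            where
            other : ∀ j → chosen s j ≢ Cycle.es (C i) a
            other j eq with edge-disjoint {j} {i} (s j , eq) (a , refl)
            ... | refl = ne (sym eq)

      basis-unchosen : ∀ X → IsBasis X → ∃[ s ] (X ≡ unchosen s)
      basis-unchosen X (acyclic , maximal) = s , ⊆-antisym X⊆ ⊆X
        where
        missing : ∀ i → ∃[ a ] (Cycle.es (C i) a ∉ X)
        missing i = ¬∀⟶∃¬ _ _ (λ a → Cycle.es (C i) a ∈? X) (λ all → acyclic (C i , all))
        s : Choice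
        s i = proj₁ (missing i)
        X⊆ : X ⊆ unchosen s
        X⊆ {e} e∈X = ∈⟦⟧⁺ (unchosen? s) (λ i eq → proj₂ (missing i) (subst (_∈ X) (sym eq) e∈X))
        ⊆X : unchosen s ⊆ X
        -- If `e` were outside `X`, then `X ∪ ⁅ e ⁆` would still lie in the acyclic set
        -- `unchosen s`, against the maximality of `X`.
        ⊆X {e} e∈ = decidable-stable (e ∈? X) λ e∉X → maximal e e∉X λ (D , D⊆) →
          unchosen-acyclic s (D , λ a → case x∈p∪q⁻ X ⁅ e ⁆ (D⊆ a) of λ
            { (inj₁ a∈X) → X⊆ a∈X
            ; (inj₂ a∈e) → subst (_∈ unchosen s) (sym (x∈⁅y⁆⇒x≡y e a∈e)) e∈ })

-- Exponents of squarefree monomials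

private variable n : ℕ

lookup-ext : {v w : Vec ℕ n} → (∀ e → lookup v e ≡ lookup w e) → v ≡ w
lookup-ext {v = v} {w} eq = ≡.trans (≡.sym (tabulate∘lookup v)) (≡.trans (tabulate-cong eq) (tabulate∘lookup w))

-- The encoding is that of `monoOf`, so `X (indicator P?)` and `monoOf ⟦ P? ⟧` agree definitionally.
indicator : {P : Pred (Fin n) 0ℓ} → Decidable P → Vec ℕ n
indicator P? = Vec.map (λ b → if b then 1 else 0) ⟦ P? ⟧

lookup-indicator : {P : Pred (Fin n) 0ℓ} (P? : Decidable P) (e : Fin n) →
                   lookup (indicator P?) e ≡ (if does (P? e) then 1 else 0)
lookup-indicator P? e = ≡.trans (lookup-map e _ ⟦ P? ⟧)
  (≡.cong (λ b → if b then 1 else 0) (lookup∘tabulate (λ e → does (P? e)) e))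

indicator-true : {P : Pred (Fin n) 0ℓ} (P? : Decidable P) {e : Fin n} → P e → lookup (indicator P?) e ≡ 1
indicator-true P? {e} Pe = ≡.trans (lookup-indicator P? e) (≡.cong (λ b → if b then 1 else 0) (dec-true (P? e) Pe))

indicator-false : {P : Pred (Fin n) 0ℓ} (P? : Decidable P) {e : Fin n} → ¬ P e → lookup (indicator P?) e ≡ 0
indicator-false P? {e} ¬Pe = ≡.trans (lookup-indicator P? e) (≡.cong (λ b → if b then 1 else 0) (dec-false (P? e) ¬Pe))

indicator-⊎ : {P Q R : Pred (Fin n) 0ℓ} (P? : Decidable P) (Q? : Decidable Q) (R? : Decidable R) →
              (∀ {e} → P e → Q e ⊎ R e) → (∀ {e} → Q e → P e) → (∀ {e} → R e → P e) →
              (∀ {e} → Q e → ¬ R e) → indicator P? ≡ indicator Q? ⊕ indicator R?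
indicator-⊎ {P = P} {Q} {R} P? Q? R? split Q⊆P R⊆P disjoint = lookup-ext λ e →
  ≡.trans (value e (Q? e) (R? e)) (≡.sym (lookup-zipWith ℕ._+_ e (indicator Q?) (indicator R?)))
  where
  value : ∀ e → Dec (Q e) → Dec (R e) →
          lookup (indicator P?) e ≡ lookup (indicator Q?) e ℕ.+ lookup (indicator R?) e
  value e (yes q) _       rewrite indicator-true P? (Q⊆P q) | indicator-true Q? q | indicator-false R? (disjoint q) = ≡.refl
  value e (no ¬q) (yes r) rewrite indicator-true P? (R⊆P r) | indicator-false Q? ¬q | indicator-true R? r = ≡.refl
  value e (no ¬q) (no ¬r) rewrite indicator-false Q? ¬q | indicator-false R? ¬r =
    indicator-false P? (λ p → case-split (split p))
    where
    case-split : ¬ (Q e ⊎ R e)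
    case-split (inj₁ q) = ¬q q
    case-split (inj₂ r) = ¬r r

indicator-disjoint : {P Q : Pred (Fin n) 0ℓ} (P? : Decidable P) (Q? : Decidable Q) →
                     (∀ {e} → P e → ¬ Q e) → Disjoint (indicator P?) (indicator Q?)
indicator-disjoint P? Q? disjoint e with P? e
... | yes p = inj₂ (indicator-false Q? (disjoint p))
... | no ¬p = inj₁ (indicator-false P? ¬p)

total : ∀ {t} → (Fin t → Vec ℕ n) → Vec ℕ n → Vec ℕ n
total {t = zero}  γ ν = ν
total {t = suc t} γ ν = γ zero ⊕ total (γ ∘ suc) ν

module _ {e : Fin n} {ν : Vec ℕ n} where
  lookup-total : ∀ {t} (γ : Fin (suc t) → Vec ℕ n) →
                 lookup (total γ ν) e ≡ lookup (γ zero) e ℕ.+ lookup (total (γ ∘ suc) ν) e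
  lookup-total γ = lookup-zipWith ℕ._+_ e (γ zero) _

  lookup-total-zero : ∀ {t} (γ : Fin t → Vec ℕ n) → (∀ i → lookup (γ i) e ≡ 0) →
                      lookup (total γ ν) e ≡ lookup ν e
  lookup-total-zero {zero}  γ γ≡0 = ≡.refl
  lookup-total-zero {suc t} γ γ≡0 rewrite lookup-total γ | γ≡0 zero = lookup-total-zero (γ ∘ suc) (γ≡0 ∘ suc)

  lookup-total-single : ∀ {t} (γ : Fin t → Vec ℕ n) i → (∀ j → j ≢ i → lookup (γ j) e ≡ 0) →
                        lookup ν e ≡ 0 → lookup (total γ ν) e ≡ lookup (γ i) e
  lookup-total-single {suc t} γ zero γ≡0 ν≡0
    rewrite lookup-total γ | lookup-total-zero (γ ∘ suc) (λ j → γ≡0 (suc j) (λ ())) | ν≡0 = ℕ.+-identityʳ _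
  lookup-total-single {suc t} γ (suc i) γ≡0 ν≡0
    rewrite lookup-total γ | γ≡0 zero (λ ()) =
      lookup-total-single (γ ∘ suc) i (λ j j≢i → γ≡0 (suc j) (j≢i ∘ suc-injective)) ν≡0

-- The resolution of the facet ideal of a cactus

module CactusResolution {c ℓ : Level} (K : Field c ℓ) (G : Graph) (cactus : GraphTheory.IsCactus G)
  {t : ℕ} (C : Fin t → GraphTheory.Cycle G)
  (distinct : ∀ i j → GraphTheory.SameEdges G (C i) (C j) → i ≡ j)
  (complete : ∀ D → ∃[ i ] GraphTheory.SameEdges G D (C i)) where
  open Graph G using (ne)
  open GraphTheory G
  open Cacti G
  open Bases cactus C distinct complete
  open PolyRing K ne hiding (ε)
  open Polynomials K ne
  open Complexes polyRing using (Factor; Linear; module Resolution)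
  open Iteration polyRing hiding (Index)
  open Matrices K ne

  module _ (i : Fin t) where
    open Cycle (C i) using (k; es; es-inj; OnCycle)
    open Cyclic (C i) using (onCycle?)

    isEdge? : ∀ a → Decidable (λ e → es a ≡ e)
    isEdge? a e = es a Fin.≟ e

    other? : ∀ a → Decidable (λ e → OnCycle e × es a ≢ e)
    other? a e = onCycle? e ×-dec ¬? (isEdge? a e)

    others? : ∀ a b → Decidable (λ e → (OnCycle e × es a ≢ e) × es b ≢ e)
    others? a b e = other? a e ×-dec ¬? (isEdge? b e)

    variable-cofactor : ∀ a → X (indicator (isEdge? a)) ⊠ X (indicator (other? a)) ≃ X (indicator onCycle?)
    variable-cofactor a = ≃-trans (X-⊕ _ _) (≃-reflexive (≡.cong X (≡.sym
      (indicator-⊎ onCycle? (isEdge? a) (other? a) split (λ eq → a , eq) proj₁ (λ eq (_ , ne) → ne eq)))))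
      where
      split : ∀ {e} → OnCycle e → es a ≡ e ⊎ (OnCycle e × es a ≢ e)
      split {e} on with isEdge? a e
      ... | yes eq = inj₁ eq
      ... | no ne  = inj₂ (on , ne)

    -- The product of the variables of the cycle other than `es a` still contains `es b`; the
    -- cofactor `others? a b` omits both edges.
    cofactor-multiple : ∀ {a b} → a ≢ b →
      X (indicator (other? a)) ≃ X (indicator (isEdge? b)) ⊠ X (indicator (others? a b))
    cofactor-multiple {a} {b} a≢b = ≃-trans (≃-reflexive (≡.cong X
      (indicator-⊎ (other? a) (isEdge? b) (others? a b) split
        (λ eq → (b , eq) , λ eq′ → a≢b (es-inj (≡.trans eq′ (≡.sym eq)))) proj₁ (λ eq (_ , ne) → ne eq))))
      (≃-sym (X-⊕ _ _))
      where
      split : ∀ {e} → OnCycle e × es a ≢ e → es b ≡ e ⊎ ((OnCycle e × es a ≢ e) × es b ≢ e)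
      split {e} on with isEdge? b e
      ... | yes eq = inj₁ eq
      ... | no ne  = inj₂ (on , ne)

    edge-nonzero : ∀ a → indicator (isEdge? a) ≢ 𝟘
    edge-nonzero a eq = ℕ.1+n≢0 (≡.trans (≡.sym (indicator-true (isEdge? a) ≡.refl))
      (≡.trans (≡.cong (λ v → lookup v (es a)) eq) (lookup-replicate (es a) 0)))

    cycle-factor : Factor In𝔪 k
    cycle-factor = record
      { x            = λ a → X (indicator (isEdge? a))
      ; g            = λ a → X (indicator (other? a))
      ; div          = λ a → quot (indicator (isEdge? a))
      ; div-additive = λ a → record { cong = quot-cong _ ; +-homo = quot-⊞ _ }
      ; div-x        = λ a → quot-X _
      ; div-g        = λ a p → quot-X-disjoint _ _ p
          (indicator-disjoint (isEdge? a) (other? a) (λ eq (_ , ne) → ne eq))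
      ; x∣g          = λ {a} {b} a≢b → X (indicator (others? a b)) , cofactor-multiple a≢b
      ; g-cancel     = λ a → X-cancel _ _
      ; x*g-const    = λ a b → ≃-trans (variable-cofactor a) (≃-sym (variable-cofactor b))
      ; x∈𝔪          = λ a p → In𝔪-X _ p (edge-nonzero a) }

  offCycles? : Decidable (λ e → ¬ (∃[ i ] Cycle.OnCycle (C i) e))
  offCycles? e = ¬? (any? (λ i → Cyclic.onCycle? (C i) e))

  family : Family In𝔪-subgroup t
  family = record
    { m        = λ i → Cycle.k (C i)
    ; factor   = cycle-factor
    ; μ        = X (indicator offCycles?)
    ; μ-cancel = X-cancel _ _
    ; div-μ    = λ i a p → quot-X-disjoint _ _ p
        (indicator-disjoint (isEdge? i a) offCycles? (λ eq off → off (i , a , eq)))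
    ; div-g    = λ {i} {j} i≢j a b p → quot-X-disjoint _ _ p
        (indicator-disjoint (isEdge? i a) (other? j b) (λ eq (on , _) → i≢j (edge-disjoint (a , eq) on))) }

  -- Formulated for every family with monomial `g` and `μ`, because the recursion in `generator`
  -- passes to `rest`.
  generator-total : ∀ {t} (𝓕 : Family In𝔪-subgroup t) (γ : ∀ i → Fin (suc (Family.m 𝓕 i)) → Monomial) ν →
    (∀ i a → Family.F.g 𝓕 i a ≃ X (γ i a)) → Family.μ 𝓕 ≃ X ν →
    ∀ s → generator In𝔪-subgroup 𝓕 s ≃ X (total (λ i → γ i (s i)) ν)
  generator-total {zero}  𝓕 γ ν g≃ μ≃ s = μ≃
  generator-total {suc t} 𝓕 γ ν g≃ μ≃ s =
    ≃-trans (≃-trans (⊠-congʳ _ (g≃ zero (s zero)))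
      (⊠-congˡ _ (generator-total (rest In𝔪-subgroup 𝓕) (λ i → γ (suc i)) ν (λ i → g≃ (suc i)) μ≃ (λ i → s (suc i)))))
      (X-⊕ _ _)

  -- An edge off all cycles occurs only in the exponent of `μ`, any other edge only in the factor of
  -- its unique cycle. Two choices appear because the choice read off an index agrees only pointwise
  -- with the prescribed one.
  total-unchosen : ∀ (s s′ : Choice) → (∀ i → s i ≡ s′ i) →
    total (λ i → indicator (other? i (s i))) (indicator offCycles?) ≡ indicator (unchosen? s′)
  total-unchosen s s′ s≡s′ = lookup-ext value
    where
    value : ∀ e → lookup (total (λ i → indicator (other? i (s i))) (indicator offCycles?)) e ≡ lookup (indicator (unchosen? s′)) e
    value e with any? (λ i → Cyclic.onCycle? (C i) e)
    ... | no off = ≡.trans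
      (lookup-total-zero _ (λ i → indicator-false (other? i (s i)) (λ (on , _) → off (i , on))))
      (≡.trans (indicator-true offCycles? off)
        (≡.sym (indicator-true (unchosen? s′) (λ i eq → off (i , s′ i , eq)))))
    ... | yes (i , on) = ≡.trans
      (lookup-total-single _ i
        (λ j j≢i → indicator-false (other? j (s j)) (λ (on′ , _) → j≢i (edge-disjoint on′ on)))
        (indicator-false offCycles? (λ off → off (i , on))))
      at-cycle
      where
      at-cycle : lookup (indicator (other? i (s i))) e ≡ lookup (indicator (unchosen? s′)) e
      at-cycle with isEdge? i (s i) e
      ... | yes eq = ≡.trans (indicator-false (other? i (s i)) (λ (_ , ne) → ne eq))
        (≡.sym (indicator-false (unchosen? s′) (λ un → un i (≡.trans (≡.cong (Cycle.es (C i)) (≡.sym (s≡s′ i))) eq))))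
      ... | no ne = ≡.trans (indicator-true (other? i (s i)) (on , ne)) (≡.sym (indicator-true (unchosen? s′) un))
        where
        un : ∀ j → chosen s′ j ≢ e
        un j eq with edge-disjoint {j} {i} (s′ j , eq) on
        ... | ≡.refl = ne (≡.trans (≡.cong (Cycle.es (C i)) (s≡s′ i)) eq)

  generator-unchosen : ∀ (s s′ : Choice) → (∀ i → s i ≡ s′ i) →
                       generator In𝔪-subgroup family s ≃ monoOf (unchosen s′)
  generator-unchosen s s′ s≡s′ = ≃-trans
    (generator-total family (λ i a → indicator (other? i a)) (indicator offCycles?) (λ _ _ → ≃-refl) ≃-refl s)
    (≃-reflexive (≡.cong X (total-unchosen s s′ s≡s′)))

  generator∈FacetIdeal : ∀ s q → q ≃ generator In𝔪-subgroup family s → FacetIdeal K G q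
  generator∈FacetIdeal s q q≃ = (X 𝟘 , unchosen s , unchosen-basis s) ∷ [] , coeff-≈ (≃-trans q≃
    (≃-trans (generator-unchosen s s (λ _ → ≡.refl)) (≃-sym one-term)))
    where
    one-term : X 𝟘 *P monoOf (unchosen s) +P 0P ≃ monoOf (unchosen s)
    one-term = ≃-trans (≃-reflexive (≡.trans (≡.sym (⊞≡+P _ 0P)) (≡.cong (_⊞ 0P) (≡.sym (⊠≡*P (X 𝟘) _)))))
      (≃-trans (⊞-comm _ 0P) (≃-trans (⊞-identityˡ _) (⊠-identityˡ _)))

  open Resolution (resolve In𝔪-subgroup family) using (aug; aug-linear)

  monoOf-aug : ∀ σ → IsBasis σ → ∃[ v ] (monoOf σ ≃ aug v)
  monoOf-aug σ basis with basis-unchosen σ basis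
  ... | s , ≡.refl = _ , ≃-sym (≃-trans (aug-δ In𝔪-subgroup family (to a)) (generator-unchosen _ s (λ i →
      ≡.trans (≡.cong (λ a′ → choice In𝔪-subgroup family a′ i) (strictlyInverseʳ a)) (choice-fromChoice In𝔪-subgroup family s i))))
    where
    open Inverse (Index↔Fin In𝔪-subgroup family 0)
    a = fromChoice In𝔪-subgroup family s

  -- The sum in `IdealGen` is local to it. The induction therefore goes over the list inside a
  -- membership proof, and the value of the tail, left to be inferred, is in the ideal by
  -- reflexivity.
  FacetIdeal-aug : ∀ L q (h : FacetIdeal K G q) → proj₁ h ≡ L → ∃[ v ] (q ≃ aug v)
  FacetIdeal-aug [] q (.[] , q≈) ≡.refl =
    (λ _ → 0P) , ≃-trans (by-coeff q≈) (≃-sym (Linear.0-homo aug-linear))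
  FacetIdeal-aug ((r , σ , basis) ∷ L) q (.((r , σ , basis) ∷ L) , q≈) ≡.refl
    with monoOf-aug σ basis | FacetIdeal-aug L _ (L , λ m → Field.refl K) ≡.refl
  ... | u , σ≃ | v , L≃ = (λ a → r ⊠ u a ⊞ v a) , (begin
    q                        ≈⟨ by-coeff q≈ ⟩
    r *P monoOf σ +P _       ≈⟨ ≃-reflexive (≡.trans (≡.sym (⊞≡+P _ _)) (≡.cong (_⊞ _) (≡.sym (⊠≡*P r _)))) ⟩
    r ⊠ monoOf σ ⊞ _         ≈⟨ ⊞-cong (⊠-congˡ r σ≃) L≃ ⟩
    r ⊠ aug u ⊞ aug v        ≈⟨ ⊞-cong (Linear.*-homo aug-linear r u) ≃-refl ⟨
    aug (λ a → r ⊠ u a) ⊞ aug v ≈⟨ Linear.+-homo aug-linear _ v ⟨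
    aug (λ a → r ⊠ u a ⊞ v a) ∎)
    where open SetoidReasoning polySetoid

  resolution : MinimalFreeResolution (FacetIdeal K G) t (λ i → rank t (λ i → Cycle.k (C i)) (toℕ i))
  resolution = minimalFreeResolution family generator∈FacetIdeal (λ q h → FacetIdeal-aug (proj₁ h) q h ≡.refl)

theorem2 : ∀ {c ℓ : Level} (K : Field c ℓ) (G : Graph) →
    GraphTheory.IsCactus G →
    (t : ℕ) → t ≥ 1 →
    (C : Fin t → GraphTheory.Cycle G) →
    (∀ i j → GraphTheory.SameEdges G (C i) (C j) → i ≡ j) →
    (∀ D → ∃[ i ] GraphTheory.SameEdges G D (C i)) →
    Σ (Fin (suc t) → ℕ) λ β →
    PolyRing.MinimalFreeResolution K (Graph.ne G) (FacetIdeal K G) t β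
    × (∀ i → + β i ≡ bettiFormula t (λ k → GraphTheory.Cycle.length (C k)) (toℕ i))
theorem2 K G cactus t _ C distinct complete =
  (λ i → rank t (λ j → GraphTheory.Cycle.k (C j)) (toℕ i)) ,
  CactusResolution.resolution K G cactus C distinct complete ,
  λ i → rank≡bettiFormula t (λ j → GraphTheory.Cycle.k (C j)) (toℕ i) (toℕ≤pred[n] i)
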